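{- Let $G$ be a graph with edge set $E$, $C\subseteq E$, and $k\ge1$. If $k=1$, then $C$ is a circuit of $M_1(G)$ iff $G\langle C\rangle$ is a bicycle. If $k\ge2$, then $C$ is a circuit of $M_k(G)$ if and only if there exist a circuit $C'$ of $M_{k-1}(G)$ and a subgraph $P$ of $G$ with $E(P)\cap C'=\emptyset$ such that $G\langle C\rangle=G\langle C'\rangle\cup P$, where $P$ is a path, a cycle, a lollipop, or a bicycle, and: (l,p) if $P$ is a lollipop or a path then $V(G\langle C'\rangle)\cap V(P)=End(P)$; (c) if $P$ is a cycle then $|V(G\langle C'\rangle)\cap V(P)|=1$; (b) if $P$ is a bicycle then $V(G\langle C'\rangle)\cap V(P)=\emptyset$.
   Context: Graphs are finite, may have loops and parallel edges. A leaf is a vertex incident to exactly one edge, which is not a loop. $\Delta H=|E(H)|-|V(H)|$. For $X\subseteq E$, $G\langle X\rangle$ is the subgraph with edge set $X$ and vertex set the vertices incident to edges of $X$. A cycle is a connected graph all of whose vertices have degree 2 (a loop contributes 2). A path with end vertices $x\neq y$ has at least one edge and $End(P)=\{x,y\}$. A lollipop is obtained from a cycle $C$ (possibly a loop) and a vertex-disjoint path with end vertices $y,x$ by identifying a vertex of $C$ with $y$; $End=\{x\}$. A bicycle is a connected graph with no leaves and $\Delta=1$. For $k\ge0$, $M_k(G)$ is the matroid on $E$ whose circuits are the inclusion-minimal members of $\{C\subseteq E:C\neq\emptyset,\ |C|=|V(G\langle C\rangle)|+k\}$. -}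

module Defs where

open import Data.Fin.Base using (Fin)
open import Data.Fin.Properties using (any?; _≟_)
open import Data.Fin.Subset
  using (Subset; _∈_; _⊆_; _∩_; _∪_; ∣_∣; ⁅_⁆; Nonempty)
open import Data.Fin.Subset.Properties using (_∈?_; x∈p∪q⁻; x∈p∪q⁺)
open import Data.Integer.Base using (ℤ; +_; _-_; 1ℤ)
open import Data.List.Base using (List; []; _∷_)
import Data.List.Membership.Propositional as List
open import Data.List.Relation.Unary.Unique.Propositional using (Unique)
open import Data.Nat.Base using (ℕ; _+_)
open import Data.Product.Base using (∃; ∃₂; ∃-syntax; Σ-syntax; _×_; _,_)
open import Data.Sum.Base using (_⊎_; inj₁; inj₂) renaming (map to ⊎-map)
open import Data.Vec.Base using (tabulate)
open import Data.Vec.Properties using (lookup∘tabulate; lookup⇒[]=; []=⇒lookup)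
open import Level using (0ℓ)
open import Relation.Binary.Construct.Closure.ReflexiveTransitive using (Star; ε; _◅_)
open import Relation.Binary.PropositionalEquality using (_≡_; _≢_; sym; trans)
open import Relation.Nullary using (¬_; Dec; does; yes; no)
open import Relation.Nullary.Decidable using (_×-dec_; _⊎-dec_; dec-true)
open import Relation.Unary using (Pred; Decidable)

select : ∀ {n} {P : Pred (Fin n) 0ℓ} → Decidable P → Subset n
select P? = tabulate (λ i → does (P? i))

∈-select⁺ : ∀ {n} {P : Pred (Fin n) 0ℓ} (P? : Decidable P) {i} → P i → i ∈ select P?
∈-select⁺ P? {i} p =
  lookup⇒[]= i _ (trans (lookup∘tabulate (λ j → does (P? j)) i) (dec-true (P? i) p))

∈-select⁻ : ∀ {n} {P : Pred (Fin n) 0ℓ} (P? : Decidable P) {i} → i ∈ select P? → P i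
∈-select⁻ P? {i} i∈
  with P? i | trans (sym (lookup∘tabulate (λ j → does (P? j)) i)) ([]=⇒lookup i∈)
... | yes p | _ = p
... | no  _ | ()

-- Finite multigraphs.  The order of the two ends of an edge carries no meaning:
-- every notion below is symmetric in src and tgt.
record Graph : Set where
  field
    order : ℕ
    size  : ℕ
    src   : Fin size → Fin order
    tgt   : Fin size → Fin order

  Vertex : Set
  Vertex = Fin order

  Edge : Set
  Edge = Fin size

  Incident : Edge → Vertex → Set
  Incident e v = src e ≡ v ⊎ tgt e ≡ v

  incident? : ∀ e v → Dec (Incident e v)
  incident? e v = (src e ≟ v) ⊎-dec (tgt e ≟ v)

  IsLoop : Edge → Set
  IsLoop e = src e ≡ tgt e

  Joins : Edge → Vertex → Vertex → Set
  Joins e u v = (src e ≡ u × tgt e ≡ v) ⊎ (src e ≡ v × tgt e ≡ u)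

module _ (G : Graph) where
  open Graph G

  record Subgraph : Set where
    constructor subgraph
    field
      V      : Subset order
      E      : Subset size
      closed : ∀ {e v} → e ∈ E → Incident e v → v ∈ V

module _ {G : Graph} where
  open Graph G
  open Subgraph

  infix  4 _≈_
  infixr 6 _∪ᴳ_

  -- Equality of subgraphs (the proof field is disregarded).
  _≈_ : Subgraph G → Subgraph G → Set
  H ≈ K = V H ≡ V K × E H ≡ E K

  _∪ᴳ_ : Subgraph G → Subgraph G → Subgraph G
  H ∪ᴳ K = subgraph (V H ∪ V K) (E H ∪ E K) λ e∈ inc →
    x∈p∪q⁺ (⊎-map (λ e∈H → closed H e∈H inc) (λ e∈K → closed K e∈K inc)
                  (x∈p∪q⁻ (E H) (E K) e∈))

  Δ : Subgraph G → ℤ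
  Δ H = + ∣ E H ∣ - + ∣ V H ∣

  -- A loop at v is counted once in each summand, hence contributes 2.
  degree : Subgraph G → Vertex → ℕ
  degree H v = ∣ E H ∩ select (λ e → src e ≟ v) ∣ + ∣ E H ∩ select (λ e → tgt e ≟ v) ∣

  IsLeaf : Subgraph G → Vertex → Set
  IsLeaf H v = v ∈ V H ×
    ∃[ e ] (e ∈ E H × Incident e v × ¬ IsLoop e × (∀ f → f ∈ E H → Incident f v → f ≡ e))

  record Step (H : Subgraph G) (u v : Vertex) : Set where
    constructor step
    field
      edge   : Edge
      edge∈E : edge ∈ E H
      joins  : Joins edge u v

  Walk : Subgraph G → Vertex → Vertex → Set
  Walk H = Star (Step H)

  vertices : ∀ {H u v} → Walk H u v → List Vertex
  vertices {u = u} ε       = u ∷ []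
  vertices {u = u} (_ ◅ w) = u ∷ vertices w

  edges : ∀ {H u v} → Walk H u v → List Edge
  edges ε       = []
  edges (s ◅ w) = Step.edge s ∷ edges w

  -- The null graph is not connected.
  Connected : Subgraph G → Set
  Connected H = Nonempty (V H) × (∀ {u v} → u ∈ V H → v ∈ V H → Walk H u v)

  IsCycle : Subgraph G → Set
  IsCycle H = Connected H × (∀ {v} → v ∈ V H → degree H v ≡ 2)

  -- H is a path with ends x ≠ y: a walk in H from x to y without repeated
  -- vertices traverses all of H.
  PathWithEnds : Subgraph G → Vertex → Vertex → Set
  PathWithEnds H x y = x ≢ y × Σ[ w ∈ Walk H x y ]
    (Unique (vertices w) ×
     (∀ {v} → v ∈ V H → v List.∈ vertices w) ×
     (∀ {e} → e ∈ E H → e List.∈ edges w))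

  IsPath : Subgraph G → Set
  IsPath H = ∃₂ λ x y → PathWithEnds H x y

  -- The identification of a vertex of K with the end y of a disjoint path is
  -- read inside G: K and Q share exactly the vertex y (hence no edge).
  LollipopWithEnd : Subgraph G → Vertex → Set
  LollipopWithEnd H x = Σ[ K ∈ Subgraph G ] Σ[ Q ∈ Subgraph G ] ∃[ y ]
    (IsCycle K × PathWithEnds Q y x × V K ∩ V Q ≡ ⁅ y ⁆ × H ≈ K ∪ᴳ Q)

  IsLollipop : Subgraph G → Set
  IsLollipop H = ∃[ x ] LollipopWithEnd H x

  IsBicycle : Subgraph G → Set
  IsBicycle H = Connected H × (∀ v → ¬ IsLeaf H v) × Δ H ≡ 1ℤ

module _ (G : Graph) where
  open Graph G

  EndOfEdgeIn : Subset size → Vertex → Set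
  EndOfEdgeIn X v = ∃[ e ] (e ∈ X × Incident e v)

  endOfEdgeIn? : ∀ X → Decidable (EndOfEdgeIn X)
  endOfEdgeIn? X v = any? (λ e → (e ∈? X) ×-dec incident? e v)

open Graph
open Subgraph

infix 8 _⟨_⟩

_⟨_⟩ : (G : Graph) → Subset (size G) → Subgraph G
G ⟨ X ⟩ = subgraph (select (endOfEdgeIn? G X)) X λ {e} e∈X inc →
  ∈-select⁺ (endOfEdgeIn? G X) (e , e∈X , inc)

Candidate : (G : Graph) → ℕ → Subset (size G) → Set
Candidate G k C = Nonempty C × ∣ C ∣ ≡ ∣ V (G ⟨ C ⟩) ∣ + k

-- C is a circuit of M_k(G).
IsCircuit : (G : Graph) → ℕ → Subset (size G) → Set
IsCircuit G k C = Candidate G k C × (∀ D → Candidate G k D → D ⊆ C → D ≡ C)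

-- Call |X| − |V(G⟨X⟩)| the defect of X; it is supermodular.  For k ≥ 1 the circuits of M_k are
-- the sets C of defect k all of whose proper subsets have smaller defect ("strict" sets).
--
-- Say that P is an ear over A ⊆ V(G) if P is connected, its vertices outside A have degree at
-- least 2, and |E(P)| = |V(P) ∖ A| + 1; all four kinds of attachment are ears over V(G⟨C′⟩).
-- Adding an ear over V(G⟨C′⟩) to a strict C′ gives a strict set with defect one larger: by
-- supermodularity only C′ ⊆ D ⊊ C′ ∪ E(P) matters, and there the vertices missed by D have
-- degree at least 2 in P and all their edges are missed by D, with slack by connectedness.
-- A bicycle is an ear over ∅, which settles k = 1.
--
-- Conversely, starting from ∅, ears inside a strict C can be added until C is exhausted.  If an
-- edge of C ∖ C′ meets V(G⟨C′⟩), follow it; since strict sets have no leaves the walk continues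
-- until it meets V(G⟨C′⟩) or itself, which yields a path, a cycle or a lollipop.  Otherwise C ∖ C′
-- has positive defect and contains a circuit of M_1, a bicycle.  The last ear added is P.

{-# OPTIONS --safe #-}
module Submission where

open import Data.Bool.Base using (true; false; if_then_else_)
open import Data.Empty using (⊥-elim)
open import Data.Fin.Base using (Fin; zero; suc)
open import Data.Fin.Properties using (_≟_; any?)
open import Data.Fin.Subset using (Subset; _∈_; _∉_; _⊆_; _⊂_; _⊃_; _∩_; _∪_; ∁; ⊥; ∣_∣; ⁅_⁆; Empty; Nonempty)
open import Data.Fin.Subset.Induction using (⊂-wellFounded; ⊃-wellFounded; Acc; acc)
open import Data.Fin.Subset.Properties
import Data.Integer.Base as ℤ
import Data.Integer.Properties as ℤ
open import Data.List.Base using (List; []; _∷_; length)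
open import Data.List.Membership.DecPropositional using () renaming (_∈?_ to member?)
open import Data.List.Membership.Propositional using () renaming (_∈_ to _∈ˡ_; _∉_ to _∉ˡ_)
open import Data.List.Relation.Unary.All as All using (All)
open import Data.List.Relation.Unary.All.Properties using (All¬⇒¬Any; ¬Any⇒All¬)
open import Data.List.Relation.Unary.AllPairs using ([]; _∷_)
open import Data.List.Relation.Unary.Any using (here; there)
open import Data.List.Relation.Unary.Unique.Propositional using (Unique)
open import Data.Nat.Base using (ℕ; zero; suc; _+_; _*_; _∸_; _≤_; _<_; z≤n; s≤s)
open import Data.Nat.Properties hiding (_≟_)
import Data.Nat.Properties as ℕ
open import Data.Nat.Tactic.RingSolver using (solve-∀)
open import Data.Product.Base using (∃-syntax; Σ-syntax; _×_; _,_; proj₁; proj₂)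
open import Data.Sum.Base using (_⊎_; inj₁; inj₂; [_,_]′)
open import Data.Vec.Base using (lookup; []; _∷_)
open import Data.Vec.Properties using ([]=⇒lookup; lookup⇒[]=)
open import Function.Base using (_∘_; case_of_)
open import Function.Bundles using (_⇔_; mk⇔)
open import Relation.Binary.Construct.Closure.ReflexiveTransitive using (ε; _◅_; _◅◅_; reverse; gmap)
open import Relation.Binary.PropositionalEquality
open import Relation.Nullary using (¬_; Dec; yes; no; contradiction)
open import Relation.Nullary.Decidable using (_×-dec_; _⊎-dec_; ¬?; decidable-stable)
open import Relation.Unary using (Decidable)
open import Defs

open import Algebra.Properties.Semiring.Sum +-*-semiring
  using (sum; sum-cong-≗; ∑-distrib-+; ∑-comm; *-distribˡ-sum; *-distribʳ-sum)

infixl 7 _∖_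

-- Sums and cardinalities

sum-mono-≤ : ∀ {n} {f g : Fin n → ℕ} → (∀ i → f i ≤ g i) → sum f ≤ sum g
sum-mono-≤ {zero}  f≤g = z≤n
sum-mono-≤ {suc n} f≤g = +-mono-≤ (f≤g zero) (sum-mono-≤ (f≤g ∘ suc))

squeeze-+ : ∀ {a b c d} → a ≤ b → c ≤ d → b + d ≤ a + c → b ≤ a × d ≤ c
squeeze-+ {a} {b} {c} {d} a≤b c≤d h =
  +-cancelʳ-≤ d b a (≤-trans h (+-monoʳ-≤ a c≤d)) ,
  +-cancelˡ-≤ b d c (≤-trans h (+-monoˡ-≤ c a≤b))

-- Equality case of `sum-mono-≤`: the reverse bound on the totals leaves no slack in any single
-- term. It serves to locate the ends of missed edges and to pin down the degrees on a cycle.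
sum-squeeze : ∀ {n} {f g : Fin n → ℕ} → (∀ i → f i ≤ g i) → sum g ≤ sum f → ∀ i → g i ≤ f i
sum-squeeze {suc n} f≤g h zero    = proj₁ (squeeze-+ (f≤g zero) (sum-mono-≤ (f≤g ∘ suc)) h)
sum-squeeze {suc n} f≤g h (suc i) =
  sum-squeeze (f≤g ∘ suc) (proj₂ (squeeze-+ (f≤g zero) (sum-mono-≤ (f≤g ∘ suc)) h)) i

-- Valued in ℕ, so that cardinalities and degrees become sums to which the semiring laws apply.
χ : ∀ {n} → Subset n → Fin n → ℕ
χ S i = if lookup S i then 1 else 0

χ-∈ : ∀ {n} {S : Subset n} {i} → i ∈ S → χ S i ≡ 1
χ-∈ i∈S rewrite []=⇒lookup i∈S = refl

χ-∉ : ∀ {n} {S : Subset n} {i} → i ∉ S → χ S i ≡ 0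
χ-∉ {S = S} {i} i∉S with lookup S i in eq
... | true  = contradiction (lookup⇒[]= i S eq) i∉S
... | false = refl

χ-∩ : ∀ {n} (S T : Subset n) i → χ (S ∩ T) i ≡ χ S i * χ T i
χ-∩ (true  ∷ S) (true  ∷ T) zero    = refl
χ-∩ (true  ∷ S) (false ∷ T) zero    = refl
χ-∩ (false ∷ S) (t     ∷ T) zero    = refl
χ-∩ (s     ∷ S) (t     ∷ T) (suc i) = χ-∩ S T i

sum-χ : ∀ {n} (S : Subset n) → sum (χ S) ≡ ∣ S ∣
sum-χ []          = refl
sum-χ (true  ∷ S) = cong suc (sum-χ S)
sum-χ (false ∷ S) = sum-χ S

sum-*-χ-⊥ : ∀ {n} (f : Fin n → ℕ) → sum (λ i → f i * χ ⊥ i) ≡ 0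
sum-*-χ-⊥ {zero}  f = refl
sum-*-χ-⊥ {suc n} f = cong₂ _+_ (*-zeroʳ (f zero)) (sum-*-χ-⊥ (f ∘ suc))

sum-*-χ-⁅⁆ : ∀ {n} (f : Fin n → ℕ) u → sum (λ i → f i * χ ⁅ u ⁆ i) ≡ f u
sum-*-χ-⁅⁆ f zero = trans (cong₂ _+_ (*-identityʳ (f zero)) (sum-*-χ-⊥ (f ∘ suc))) (+-identityʳ _)
sum-*-χ-⁅⁆ f (suc u) = trans (cong (_+ sum (λ i → f (suc i) * χ ⁅ u ⁆ i)) (*-zeroʳ (f zero))) (sum-*-χ-⁅⁆ (f ∘ suc) u)

∣p∪q∣+∣p∩q∣ : ∀ {n} (p q : Subset n) → ∣ p ∪ q ∣ + ∣ p ∩ q ∣ ≡ ∣ p ∣ + ∣ q ∣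
∣p∪q∣+∣p∩q∣ []          []          = refl
∣p∪q∣+∣p∩q∣ (true  ∷ p) (true  ∷ q) =
  cong suc (trans (+-suc _ _) (trans (cong suc (∣p∪q∣+∣p∩q∣ p q)) (sym (+-suc _ _))))
∣p∪q∣+∣p∩q∣ (true  ∷ p) (false ∷ q) = cong suc (∣p∪q∣+∣p∩q∣ p q)
∣p∪q∣+∣p∩q∣ (false ∷ p) (true  ∷ q) = trans (cong suc (∣p∪q∣+∣p∩q∣ p q)) (sym (+-suc _ _))
∣p∪q∣+∣p∩q∣ (false ∷ p) (false ∷ q) = ∣p∪q∣+∣p∩q∣ p q

_∖_ : ∀ {n} → Subset n → Subset n → Subset n
p ∖ q = p ∩ ∁ q

x∈p∖q⁺ : ∀ {n} {p q : Subset n} {x} → x ∈ p → x ∉ q → x ∈ p ∖ q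
x∈p∖q⁺ x∈p x∉q = x∈p∩q⁺ (x∈p , x∉p⇒x∈∁p x∉q)

x∈p∖q⁻ : ∀ {n} (p q : Subset n) {x} → x ∈ p ∖ q → x ∈ p × x ∉ q
x∈p∖q⁻ p q x∈ = proj₁ (x∈p∩q⁻ p (∁ q) x∈) , x∈∁p⇒x∉p (proj₂ (x∈p∩q⁻ p (∁ q) x∈))

p∖q⊆p : ∀ {n} (p q : Subset n) → p ∖ q ⊆ p
p∖q⊆p p q = p∩q⊆p p (∁ q)

∣p∩q∣+∣p∖q∣≡∣p∣ : ∀ {n} (p q : Subset n) → ∣ p ∩ q ∣ + ∣ p ∖ q ∣ ≡ ∣ p ∣
∣p∩q∣+∣p∖q∣≡∣p∣ []          []          = refl
∣p∩q∣+∣p∖q∣≡∣p∣ (true  ∷ p) (true  ∷ q) = cong suc (∣p∩q∣+∣p∖q∣≡∣p∣ p q)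
∣p∩q∣+∣p∖q∣≡∣p∣ (true  ∷ p) (false ∷ q) = trans (+-suc _ _) (cong suc (∣p∩q∣+∣p∖q∣≡∣p∣ p q))
∣p∩q∣+∣p∖q∣≡∣p∣ (false ∷ p) (_     ∷ q) = ∣p∩q∣+∣p∖q∣≡∣p∣ p q

q⊆p⇒∣p∣≡∣q∣+∣p∖q∣ : ∀ {n} (p q : Subset n) → q ⊆ p → ∣ p ∣ ≡ ∣ q ∣ + ∣ p ∖ q ∣
q⊆p⇒∣p∣≡∣q∣+∣p∖q∣ p q q⊆p = trans (sym (∣p∩q∣+∣p∖q∣≡∣p∣ p q))
  (cong (λ r → ∣ r ∣ + ∣ p ∖ q ∣) (⊆-antisym (p∩q⊆q p q) λ x∈q → x∈p∩q⁺ (q⊆p x∈q , x∈q)))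

x∈p⇒∣p∣≡1+∣p∖x∣ : ∀ {n} (p : Subset n) x → x ∈ p → ∣ p ∣ ≡ suc ∣ p ∖ ⁅ x ⁆ ∣
x∈p⇒∣p∣≡1+∣p∖x∣ p x x∈p = trans
  (q⊆p⇒∣p∣≡∣q∣+∣p∖q∣ p ⁅ x ⁆ λ y∈ → subst (_∈ p) (sym (x∈⁅y⁆⇒x≡y x y∈)) x∈p)
  (cong (_+ ∣ p ∖ ⁅ x ⁆ ∣) (∣⁅x⁆∣≡1 x))

Empty⇒∣p∣≡0 : ∀ {n} {p : Subset n} → Empty p → ∣ p ∣ ≡ 0
Empty⇒∣p∣≡0 {n} empty = trans (cong ∣_∣ (Empty-unique empty)) (∣⊥∣≡0 n)

0<∣p∣⇒Nonempty : ∀ {n} (p : Subset n) → 0 < ∣ p ∣ → Nonempty p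
0<∣p∣⇒Nonempty p 0<∣p∣ with nonempty? p
... | yes ne = ne
... | no ¬ne = contradiction (Empty⇒∣p∣≡0 ¬ne) (m<n⇒n≢0 0<∣p∣)

∣p∪q∣-disjoint : ∀ {n} (p q : Subset n) → Empty (p ∩ q) → ∣ p ∪ q ∣ ≡ ∣ p ∣ + ∣ q ∣
∣p∪q∣-disjoint p q empty = trans (sym (+-identityʳ _))
  (trans (cong (∣ p ∪ q ∣ +_) (sym (Empty⇒∣p∣≡0 empty))) (∣p∪q∣+∣p∩q∣ p q))

∪-lub : ∀ {n} {p q r : Subset n} → p ⊆ r → q ⊆ r → p ∪ q ⊆ r
∪-lub {p = p} {q} p⊆r q⊆r x∈ = [ p⊆r , q⊆r ]′ (x∈p∪q⁻ p q x∈)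

-- Since membership is decidable, an element of `p` outside `q` may be assumed to exist; this allows
-- inclusions to be proved by contradiction.
⊆-dec-stable : ∀ {n} (p q : Subset n) → (Nonempty (p ∖ q) → p ⊆ q) → p ⊆ q
⊆-dec-stable p q h {x} x∈p with x ∈? q
... | yes x∈q = x∈q
... | no  x∉q = h (x , x∈p∖q⁺ x∈p x∉q) x∈p

χ≤1 : ∀ {n} (S : Subset n) i → χ S i ≤ 1
χ≤1 S i with i ∈? S
... | yes i∈S = ≤-reflexive (χ-∈ i∈S)
... | no  i∉S = ≤-trans (≤-reflexive (χ-∉ i∉S)) z≤n

2≤χ+χ⇒∈ : ∀ {n} (S : Subset n) i j → 2 ≤ χ S i + χ S j → i ∈ S × j ∈ S
2≤χ+χ⇒∈ S i j 2≤ with i ∈? S | j ∈? S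
... | yes i∈ | yes j∈ = i∈ , j∈
... | no  i∉ | _ rewrite χ-∉ i∉ = contradiction (≤-trans 2≤ (χ≤1 S j)) λ { (s≤s ()) }
... | _ | no  j∉ rewrite χ-∉ j∉ | +-identityʳ (χ S i) =
  contradiction (≤-trans 2≤ (χ≤1 S i)) λ { (s≤s ()) }

sum-χ-*2 : ∀ {n} (S : Subset n) → sum (λ i → χ S i * 2) ≡ ∣ S ∣ * 2
sum-χ-*2 {n} S = trans (sym (*-distribʳ-sum {n} 2 (χ S))) (cong (_* 2) (sum-χ S))

m-n≡1⇒m≡1+n : ∀ {m n} → ℤ.+ m ℤ.- ℤ.+ n ≡ ℤ.1ℤ → m ≡ suc n
m-n≡1⇒m≡1+n {m} {n} eq = ℤ.+-injective (begin
  ℤ.+ m                              ≡⟨ ℤ.+-identityʳ (ℤ.+ m) ⟨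
  ℤ.+ m ℤ.+ ℤ.0ℤ                     ≡⟨ cong (λ i → ℤ.+ m ℤ.+ i) (ℤ.+-inverseˡ (ℤ.+ n)) ⟨
  ℤ.+ m ℤ.+ (ℤ.- ℤ.+ n ℤ.+ ℤ.+ n)    ≡⟨ ℤ.+-assoc (ℤ.+ m) (ℤ.- ℤ.+ n) (ℤ.+ n) ⟨
  ℤ.+ m ℤ.- ℤ.+ n ℤ.+ ℤ.+ n          ≡⟨ cong (λ i → i ℤ.+ ℤ.+ n) eq ⟩
  ℤ.1ℤ ℤ.+ ℤ.+ n                     ∎)
  where open ≡-Reasoning

m≡1+n⇒m-n≡1 : ∀ {m n} → m ≡ suc n → ℤ.+ m ℤ.- ℤ.+ n ≡ ℤ.1ℤ
m≡1+n⇒m-n≡1 {n = n} refl = begin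
  ℤ.1ℤ ℤ.+ ℤ.+ n ℤ.- ℤ.+ n           ≡⟨ ℤ.+-assoc ℤ.1ℤ (ℤ.+ n) (ℤ.- ℤ.+ n) ⟩
  ℤ.1ℤ ℤ.+ (ℤ.+ n ℤ.- ℤ.+ n)         ≡⟨ cong (λ i → ℤ.1ℤ ℤ.+ i) (ℤ.+-inverseʳ (ℤ.+ n)) ⟩
  ℤ.1ℤ                               ∎
  where open ≡-Reasoning

-- Each step removes the head of the list from `S`; uniqueness keeps the tail inside the smaller
-- set.
∣S∣≡length : ∀ {n} {S : Subset n} xs → Unique xs →
  (∀ {i} → i ∈ S → i ∈ˡ xs) → (∀ {i} → i ∈ˡ xs → i ∈ S) → ∣ S ∣ ≡ length xs
∣S∣≡length [] [] S⊆ ⊆S = Empty⇒∣p∣≡0 λ (i , i∈) → case S⊆ i∈ of λ ()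
∣S∣≡length {S = S} (x ∷ xs) (x∉ ∷ unique) S⊆ ⊆S = trans (x∈p⇒∣p∣≡1+∣p∖x∣ S x (⊆S (here refl)))
  (cong suc (∣S∣≡length {S = S ∖ ⁅ x ⁆} xs unique fwd bwd))
  where
  fwd : ∀ {i} → i ∈ S ∖ ⁅ x ⁆ → i ∈ˡ xs
  fwd i∈ with x∈p∖q⁻ S ⁅ x ⁆ i∈
  ... | i∈S , i∉x with S⊆ i∈S
  ...   | here refl = contradiction (x∈⁅x⁆ x) i∉x
  ...   | there i∈xs = i∈xs
  bwd : ∀ {i} → i ∈ˡ xs → i ∈ S ∖ ⁅ x ⁆
  bwd i∈ = x∈p∖q⁺ (⊆S (there i∈)) λ i∈x →
    All¬⇒¬Any x∉ (subst (_∈ˡ xs) (x∈⁅y⁆⇒x≡y x i∈x) i∈)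

∣⁅x⁆∪⁅y⁆∣≡2 : ∀ {n} {x y : Fin n} → x ≢ y → ∣ ⁅ x ⁆ ∪ ⁅ y ⁆ ∣ ≡ 2
∣⁅x⁆∪⁅y⁆∣≡2 {x = x} {y} x≢y = trans (∣p∪q∣-disjoint ⁅ x ⁆ ⁅ y ⁆ λ (z , z∈) →
    let z∈x , z∈y = x∈p∩q⁻ ⁅ x ⁆ ⁅ y ⁆ z∈ in
    x≢y (trans (sym (x∈⁅y⁆⇒x≡y x z∈x)) (x∈⁅y⁆⇒x≡y y z∈y)))
  (cong₂ _+_ (∣⁅x⁆∣≡1 x) (∣⁅x⁆∣≡1 y))

fromList : ∀ {n} → List (Fin n) → Subset n
fromList xs = select (λ i → member? _≟_ i xs)

∈-fromList⁺ : ∀ {n} {xs : List (Fin n)} {i} → i ∈ˡ xs → i ∈ fromList xs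
∈-fromList⁺ {xs = xs} = ∈-select⁺ (λ i → member? _≟_ i xs)

∈-fromList⁻ : ∀ {n} {xs : List (Fin n)} {i} → i ∈ fromList xs → i ∈ˡ xs
∈-fromList⁻ {xs = xs} = ∈-select⁻ (λ i → member? _≟_ i xs)

∣fromList∣ : ∀ {n} {xs : List (Fin n)} → Unique xs → ∣ fromList xs ∣ ≡ length xs
∣fromList∣ {xs = xs} unique = ∣S∣≡length {S = fromList xs} xs unique ∈-fromList⁻ ∈-fromList⁺

p∩q≡⁅x⁆ : ∀ {n} {p q : Subset n} {x} → x ∈ p → x ∈ q →
  (∀ {y} → y ∈ p → y ∈ q → y ≡ x) → p ∩ q ≡ ⁅ x ⁆
p∩q≡⁅x⁆ {p = p} {q} {x} x∈p x∈q only = ⊆-antisym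
  (λ y∈ → let y∈p , y∈q = x∈p∩q⁻ p q y∈ in subst (_∈ ⁅ x ⁆) (sym (only y∈p y∈q)) (x∈⁅x⁆ x))
  (λ y∈x → subst (_∈ p ∩ q) (sym (x∈⁅y⁆⇒x≡y x y∈x)) (x∈p∩q⁺ (x∈p , x∈q)))

module EarDecomposition (G : Graph) where
  open Graph G
  open Subgraph

  -- Degrees

  -- A loop at `v` gives 2, in agreement with `degree`.
  incidence : Edge → Vertex → ℕ
  incidence e v = χ ⁅ src e ⁆ v + χ ⁅ tgt e ⁆ v

  Incident⇒1≤incidence : ∀ {e v} → Incident e v → 1 ≤ incidence e v
  Incident⇒1≤incidence {e} {v} (inj₁ refl) =
    ≤-trans (≤-reflexive (sym (χ-∈ (x∈⁅x⁆ v)))) (m≤m+n _ _)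
  Incident⇒1≤incidence {e} {v} (inj₂ refl) =
    ≤-trans (≤-reflexive (sym (χ-∈ (x∈⁅x⁆ v)))) (m≤n+m _ _)

  loop⇒2≤incidence : ∀ {e v} → IsLoop e → Incident e v → 2 ≤ incidence e v
  loop⇒2≤incidence {e} {v} loop inc =
    ≤-reflexive (sym (cong₂ _+_ (χ-∈ (on-src inc)) (χ-∈ (on-tgt inc))))
    where
    on-src : Incident e v → v ∈ ⁅ src e ⁆
    on-src (inj₁ refl) = x∈⁅x⁆ _
    on-src (inj₂ refl) rewrite loop = x∈⁅x⁆ _
    on-tgt : Incident e v → v ∈ ⁅ tgt e ⁆
    on-tgt (inj₁ refl) rewrite loop = x∈⁅x⁆ _
    on-tgt (inj₂ refl) = x∈⁅x⁆ _

  ¬loop⇒incidence≤1 : ∀ {e v} → ¬ IsLoop e → incidence e v ≤ 1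
  ¬loop⇒incidence≤1 {e} {v} ¬loop with src e ≟ v | tgt e ≟ v
  ... | yes refl | yes eq = contradiction (sym eq) ¬loop
  ... | yes refl | no ≢  = ≤-reflexive (cong₂ _+_ (χ-∈ (x∈⁅x⁆ v)) (χ-∉ (≢ ∘ sym ∘ x∈⁅y⁆⇒x≡y _)))
  ... | no ≢ | yes refl = ≤-reflexive (cong₂ _+_ (χ-∉ (≢ ∘ sym ∘ x∈⁅y⁆⇒x≡y _)) (χ-∈ (x∈⁅x⁆ v)))
  ... | no ≢ | no ≢′ = ≤-trans
    (≤-reflexive (cong₂ _+_ (χ-∉ (≢ ∘ sym ∘ x∈⁅y⁆⇒x≡y _)) (χ-∉ (≢′ ∘ sym ∘ x∈⁅y⁆⇒x≡y _)))) z≤n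

  ¬Incident⇒incidence≡0 : ∀ {e v} → ¬ Incident e v → incidence e v ≡ 0
  ¬Incident⇒incidence≡0 ¬inc = cong₂ _+_
    (χ-∉ (¬inc ∘ inj₁ ∘ sym ∘ x∈⁅y⁆⇒x≡y _)) (χ-∉ (¬inc ∘ inj₂ ∘ sym ∘ x∈⁅y⁆⇒x≡y _))

  χ-select-≟ : ∀ (f : Edge → Vertex) v e → χ (select (λ i → f i ≟ v)) e ≡ χ ⁅ f e ⁆ v
  χ-select-≟ f v e with f e ≟ v
  ... | yes eq = trans (χ-∈ (∈-select⁺ (λ i → f i ≟ v) eq))
                       (sym (χ-∈ (subst (λ u → v ∈ ⁅ u ⁆) (sym eq) (x∈⁅x⁆ v))))
  ... | no ≢   = trans (χ-∉ (≢ ∘ ∈-select⁻ (λ i → f i ≟ v)))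
                       (sym (χ-∉ (≢ ∘ sym ∘ x∈⁅y⁆⇒x≡y _)))

  degree-sum : ∀ (H : Subgraph G) v → degree H v ≡ sum (λ e → χ (E H) e * incidence e v)
  degree-sum H v = begin
    degree H v
      ≡⟨ cong₂ _+_ (count src) (count tgt) ⟩
    sum (λ e → χ (E H) e * χ ⁅ src e ⁆ v) + sum (λ e → χ (E H) e * χ ⁅ tgt e ⁆ v)
      ≡⟨ ∑-distrib-+ {size} _ _ ⟨
    sum (λ e → χ (E H) e * χ ⁅ src e ⁆ v + χ (E H) e * χ ⁅ tgt e ⁆ v)
      ≡⟨ sum-cong-≗ {size} (λ e → *-distribˡ-+ (χ (E H) e) _ _) ⟨
    sum (λ e → χ (E H) e * incidence e v) ∎
    where
    open ≡-Reasoning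
    count : ∀ (f : Edge → Vertex) →
      ∣ E H ∩ select (λ e → f e ≟ v) ∣ ≡ sum (λ e → χ (E H) e * χ ⁅ f e ⁆ v)
    count f = trans (sym (sum-χ (E H ∩ select (λ e → f e ≟ v)))) (sum-cong-≗ {size} λ e →
      trans (χ-∩ (E H) (select (λ i → f i ≟ v)) e) (cong (χ (E H) e *_) (χ-select-≟ f v e)))

  -- Both sides count the pairs of an edge of `H` and one of its ends in `W`, a loop giving two such
  -- pairs; the sums over vertices and edges are exchanged.
  double-counting : ∀ (H : Subgraph G) (W : Subset order) →
    sum (λ v → χ W v * degree H v) ≡ sum (λ e → χ (E H) e * (χ W (src e) + χ W (tgt e)))
  double-counting H W = begin
    sum (λ v → χ W v * degree H v)
      ≡⟨ sum-cong-≗ {order} (λ v → trans (cong (χ W v *_) (degree-sum H v)) (*-distribˡ-sum {size} (χ W v) _)) ⟩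
    sum (λ v → sum (λ e → χ W v * (χ (E H) e * incidence e v)))
      ≡⟨ ∑-comm {order} {size} _ ⟩
    sum (λ e → sum (λ v → χ W v * (χ (E H) e * incidence e v)))
      ≡⟨ sum-cong-≗ {size} (λ e → sum-cong-≗ {order} λ v → rearrange (χ W v) (χ (E H) e) _ _) ⟩
    sum (λ e → sum (λ v → χ (E H) e * (χ W v * χ ⁅ src e ⁆ v + χ W v * χ ⁅ tgt e ⁆ v)))
      ≡⟨ sum-cong-≗ {size} (λ e → *-distribˡ-sum {order} (χ (E H) e) _) ⟨
    sum (λ e → χ (E H) e * sum (λ v → χ W v * χ ⁅ src e ⁆ v + χ W v * χ ⁅ tgt e ⁆ v))
      ≡⟨ sum-cong-≗ {size} (λ e → cong (χ (E H) e *_) (trans (∑-distrib-+ {order} _ _)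
           (cong₂ _+_ (sum-*-χ-⁅⁆ (χ W) (src e)) (sum-*-χ-⁅⁆ (χ W) (tgt e))))) ⟩
    sum (λ e → χ (E H) e * (χ W (src e) + χ W (tgt e))) ∎
    where
    open ≡-Reasoning
    rearrange : ∀ w h s t → w * (h * (s + t)) ≡ h * (w * s + w * t)
    rearrange = solve-∀

  degree-mono : ∀ {H K : Subgraph G} v → E H ⊆ E K → degree H v ≤ degree K v
  degree-mono {H} {K} v H⊆K = +-mono-≤ (mono (λ e → src e ≟ v)) (mono (λ e → tgt e ≟ v))
    where
    mono : ∀ {P} (P? : Decidable P) → ∣ E H ∩ select P? ∣ ≤ ∣ E K ∩ select P? ∣
    mono P? = p⊆q⇒∣p∣≤∣q∣ {p = E H ∩ select P?} {E K ∩ select P?} λ e∈ →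
      let e∈H , e∈P = x∈p∩q⁻ (E H) (select P?) e∈ in x∈p∩q⁺ (H⊆K e∈H , e∈P)

  -- The indicators of `e` and `f` are never both 1, so edge by edge their sum is at most the
  -- contribution to the degree.
  two-edges⇒2≤degree : ∀ {H : Subgraph G} {e f v} → e ∈ E H → f ∈ E H → e ≢ f →
    Incident e v → Incident f v → 2 ≤ degree H v
  two-edges⇒2≤degree {H} {e} {f} {v} e∈ f∈ e≢f e-v f-v = begin
    2                                        ≡⟨ cong₂ _+_ (∣⁅x⁆∣≡1 e) (∣⁅x⁆∣≡1 f) ⟨
    ∣ ⁅ e ⁆ ∣ + ∣ ⁅ f ⁆ ∣                    ≡⟨ cong₂ _+_ (sum-χ ⁅ e ⁆) (sum-χ ⁅ f ⁆) ⟨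
    sum (χ ⁅ e ⁆) + sum (χ ⁅ f ⁆)            ≡⟨ ∑-distrib-+ {size} _ _ ⟨
    sum (λ i → χ ⁅ e ⁆ i + χ ⁅ f ⁆ i)        ≤⟨ sum-mono-≤ bound ⟩
    sum (λ i → χ (E H) i * incidence i v)    ≡⟨ degree-sum H v ⟨
    degree H v                               ∎
    where
    open ≤-Reasoning
    bound : ∀ i → χ ⁅ e ⁆ i + χ ⁅ f ⁆ i ≤ χ (E H) i * incidence i v
    bound i with i ≟ e | i ≟ f
    ... | yes refl | yes i≡f = contradiction i≡f e≢f
    ... | yes refl | no i≢f rewrite χ-∈ (x∈⁅x⁆ i) | χ-∉ (x≢y⇒x∉⁅y⁆ i≢f) | χ-∈ e∈ =
      ≤-trans (Incident⇒1≤incidence e-v) (m≤m+n _ _)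
    ... | no i≢e | yes refl rewrite χ-∈ (x∈⁅x⁆ i) | χ-∉ (x≢y⇒x∉⁅y⁆ i≢e) | χ-∈ f∈ =
      ≤-trans (Incident⇒1≤incidence f-v) (m≤m+n _ _)
    ... | no i≢e | no i≢f rewrite χ-∉ (x≢y⇒x∉⁅y⁆ i≢e) | χ-∉ (x≢y⇒x∉⁅y⁆ i≢f) = z≤n

  loop⇒2≤degree : ∀ {H : Subgraph G} {e v} → e ∈ E H → IsLoop e → Incident e v → 2 ≤ degree H v
  loop⇒2≤degree {H} {e} {v} e∈ loop e-v = begin
    2                                        ≤⟨ loop⇒2≤incidence loop e-v ⟩
    incidence e v                            ≡⟨ sum-*-χ-⁅⁆ (λ i → incidence i v) e ⟨
    sum (λ i → incidence i v * χ ⁅ e ⁆ i)    ≤⟨ sum-mono-≤ bound ⟩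
    sum (λ i → χ (E H) i * incidence i v)    ≡⟨ degree-sum H v ⟨
    degree H v                               ∎
    where
    open ≤-Reasoning
    bound : ∀ i → incidence i v * χ ⁅ e ⁆ i ≤ χ (E H) i * incidence i v
    bound i with i ≟ e
    ... | yes refl rewrite χ-∈ (x∈⁅x⁆ i) | χ-∈ e∈ = ≤-reflexive (*-comm (incidence i v) 1)
    ... | no i≢e rewrite χ-∉ (x≢y⇒x∉⁅y⁆ i≢e) = ≤-trans (≤-reflexive (*-zeroʳ (incidence i v))) z≤n

  leaf⇒degree≤1 : ∀ {H : Subgraph G} {v} → IsLeaf H v → degree H v ≤ 1
  leaf⇒degree≤1 {H} {v} (v∈ , e , e∈ , e-v , ¬loop , unique) = begin
    degree H v                               ≡⟨ degree-sum H v ⟩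
    sum (λ i → χ (E H) i * incidence i v)    ≤⟨ sum-mono-≤ bound ⟩
    sum (χ ⁅ e ⁆)                            ≡⟨ sum-χ ⁅ e ⁆ ⟩
    ∣ ⁅ e ⁆ ∣                                ≡⟨ ∣⁅x⁆∣≡1 e ⟩
    1                                        ∎
    where
    open ≤-Reasoning
    bound : ∀ i → χ (E H) i * incidence i v ≤ χ ⁅ e ⁆ i
    bound i with i ∈? E H | incident? i v
    ... | no i∉  | _ rewrite χ-∉ i∉ = z≤n
    ... | yes _  | no ¬i-v = ≤-trans (≤-reflexive
      (trans (cong (χ (E H) i *_) (¬Incident⇒incidence≡0 ¬i-v)) (*-zeroʳ (χ (E H) i)))) z≤n
    ... | yes i∈ | yes i-v with unique i i∈ i-v
    ...   | refl rewrite χ-∈ i∈ | χ-∈ (x∈⁅x⁆ i) =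
      ≤-trans (≤-reflexive (+-identityʳ _)) (¬loop⇒incidence≤1 ¬loop)

  -- An isolated vertex is no leaf either, hence the given edge `e`. If `e` is not a loop, a second
  -- edge must meet `v`, for otherwise `e` would make `v` a leaf.
  ¬leaf⇒2≤degree : ∀ {H : Subgraph G} {e v} → ¬ IsLeaf H v → e ∈ E H → Incident e v → 2 ≤ degree H v
  ¬leaf⇒2≤degree {H} {e} {v} ¬leaf e∈ e-v with src e ≟ tgt e
  ... | yes loop = loop⇒2≤degree {H} e∈ loop e-v
  ... | no ¬loop with any? (λ f → (f ∈? E H) ×-dec (incident? f v ×-dec ¬? (e ≟ f)))
  ...   | yes (f , f∈ , f-v , e≢f) = two-edges⇒2≤degree {H} e∈ f∈ e≢f e-v f-v
  ...   | no none = contradiction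
    (closed H e∈ e-v , e , e∈ , e-v , ¬loop ,
     λ f f∈ f-v → sym (decidable-stable (e ≟ f) λ e≢f → none (f , f∈ , f-v , e≢f))) ¬leaf

  -- Strict edge sets

  V⟨_⟩ : Subset size → Subset order
  V⟨ X ⟩ = V (G ⟨ X ⟩)

  ν : Subset size → ℕ
  ν X = ∣ V⟨ X ⟩ ∣

  ∈V⟨⟩⁻ : ∀ {X v} → v ∈ V⟨ X ⟩ → ∃[ e ] (e ∈ X × Incident e v)
  ∈V⟨⟩⁻ {X} = ∈-select⁻ (endOfEdgeIn? G X)

  V⟨⟩-mono : ∀ {X Y} → X ⊆ Y → V⟨ X ⟩ ⊆ V⟨ Y ⟩
  V⟨⟩-mono {X} {Y} X⊆Y v∈ = let e , e∈ , e-v = ∈V⟨⟩⁻ {X} v∈ in closed (G ⟨ Y ⟩) (X⊆Y e∈) e-v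

  V⟨⟩-∪ : ∀ X Y → V⟨ X ∪ Y ⟩ ≡ V⟨ X ⟩ ∪ V⟨ Y ⟩
  V⟨⟩-∪ X Y = ⊆-antisym split (∪-lub (V⟨⟩-mono (p⊆p∪q Y)) (V⟨⟩-mono (q⊆p∪q X Y)))
    where
    split : V⟨ X ∪ Y ⟩ ⊆ V⟨ X ⟩ ∪ V⟨ Y ⟩
    split v∈ with ∈V⟨⟩⁻ {X ∪ Y} v∈
    ... | e , e∈ , e-v with x∈p∪q⁻ X Y e∈
    ...   | inj₁ e∈X = x∈p∪q⁺ (inj₁ (closed (G ⟨ X ⟩) e∈X e-v))
    ...   | inj₂ e∈Y = x∈p∪q⁺ (inj₂ (closed (G ⟨ Y ⟩) e∈Y e-v))

  -- Equality can fail because a vertex may meet `X` and `Y` in different edges only. As cardinality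
  -- is modular, this is the supermodularity of the defect.
  ν-submodular : ∀ X Y → ν (X ∪ Y) + ν (X ∩ Y) ≤ ν X + ν Y
  ν-submodular X Y = begin
    ν (X ∪ Y) + ν (X ∩ Y)
      ≤⟨ +-mono-≤ (≤-reflexive (cong ∣_∣ (V⟨⟩-∪ X Y))) (p⊆q⇒∣p∣≤∣q∣ both) ⟩
    ∣ V⟨ X ⟩ ∪ V⟨ Y ⟩ ∣ + ∣ V⟨ X ⟩ ∩ V⟨ Y ⟩ ∣
      ≡⟨ ∣p∪q∣+∣p∩q∣ V⟨ X ⟩ V⟨ Y ⟩ ⟩
    ν X + ν Y ∎
    where
    open ≤-Reasoning
    both : V⟨ X ∩ Y ⟩ ⊆ V⟨ X ⟩ ∩ V⟨ Y ⟩
    both v∈ = x∈p∩q⁺ (V⟨⟩-mono (p∩q⊆p X Y) v∈ , V⟨⟩-mono (p∩q⊆q X Y) v∈)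

  -- Every proper subset has smaller defect, with both sides moved to avoid truncated subtraction.
  Strict : Subset size → Set
  Strict C = ∀ D → D ⊆ C → ∣ C ∣ + ν D ≤ ∣ D ∣ + ν C → C ⊆ D

  -- If the comparison goes the other way, strictness forces `D` to be `C`.
  strict⇒defect≤ : ∀ {C} → Strict C → ∀ D → D ⊆ C → ∣ D ∣ + ν C ≤ ∣ C ∣ + ν D
  strict⇒defect≤ {C} strict D D⊆C with ≤-total (∣ D ∣ + ν C) (∣ C ∣ + ν D)
  ... | inj₁ D≤C = D≤C
  ... | inj₂ C≤D with ⊆-antisym D⊆C (strict D D⊆C C≤D)
  ...   | refl = ≤-refl

  -- Adding an ear to a strict set

  record Ear (A : Subset order) (P : Subgraph G) : Set where
    field
      connect   : ∀ {u v} → u ∈ V P → v ∈ V P → Walk P u v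
      branching : ∀ {v} → v ∈ V P → v ∉ A → 2 ≤ degree P v
      count     : ∣ E P ∣ ≡ suc ∣ V P ∖ A ∣

  -- The vertices of `P` need not all be ends of its edges; `V≡` excludes isolated vertices of `P`
  -- outside `V⟨ C′ ⟩`.
  module AddEar {C′ : Subset size} {P : Subgraph G} (ear : Ear V⟨ C′ ⟩ P)
                (disjoint : Empty (E P ∩ C′)) (V≡ : V⟨ C′ ∪ E P ⟩ ≡ V⟨ C′ ⟩ ∪ V P) where
    open Ear ear

    C : Subset size
    C = C′ ∪ E P

    ∣C∣≡ : ∣ C ∣ ≡ ∣ C′ ∣ + suc ∣ V P ∖ V⟨ C′ ⟩ ∣
    ∣C∣≡ = trans (∣p∪q∣-disjoint C′ (E P) λ (e , e∈) →
        disjoint (e , subst (e ∈_) (∩-comm C′ (E P)) e∈))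
      (cong (∣ C′ ∣ +_) count)

    νC≡ : ν C ≡ ν C′ + ∣ V P ∖ V⟨ C′ ⟩ ∣
    νC≡ = trans (q⊆p⇒∣p∣≡∣q∣+∣p∖q∣ V⟨ C ⟩ V⟨ C′ ⟩ (V⟨⟩-mono (p⊆p∪q (E P))))
      (cong (λ S → ν C′ + ∣ S ∣) (⊆-antisym fwd bwd))
      where
      fwd : V⟨ C ⟩ ∖ V⟨ C′ ⟩ ⊆ V P ∖ V⟨ C′ ⟩
      fwd v∈ with x∈p∖q⁻ V⟨ C ⟩ V⟨ C′ ⟩ v∈
      ... | v∈C , v∉ with x∈p∪q⁻ V⟨ C′ ⟩ (V P) (subst (_ ∈_) V≡ v∈C)
      ...   | inj₁ v∈C′ = contradiction v∈C′ v∉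
      ...   | inj₂ v∈P  = x∈p∖q⁺ v∈P v∉
      bwd : V P ∖ V⟨ C′ ⟩ ⊆ V⟨ C ⟩ ∖ V⟨ C′ ⟩
      bwd v∈ with x∈p∖q⁻ (V P) V⟨ C′ ⟩ v∈
      ... | v∈P , v∉ = x∈p∖q⁺ (subst (_ ∈_) (sym V≡) (x∈p∪q⁺ (inj₂ v∈P))) v∉

    -- The ear brings one more edge than it brings new vertices.
    defect-suc : ∣ C ∣ + ν C′ ≡ suc (∣ C′ ∣ + ν C)
    defect-suc = trans (cong (_+ ν C′) ∣C∣≡)
      (trans (rearrange (∣ C′ ∣) (∣ V P ∖ V⟨ C′ ⟩ ∣) (ν C′)) (cong (λ m → suc (∣ C′ ∣ + m)) (sym νC≡)))
      where
      rearrange : ∀ c m n → c + suc m + n ≡ suc (c + (n + m))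
      rearrange = solve-∀

    -- Here `D` lies between `C′` and `C` and has at least the defect of `C`. The sets `R` and `W`
    -- consist of the edges and vertices that `D` misses; the aim is that `R` is empty.
    module _ (D : Subset size) (C′⊆D : C′ ⊆ D) (D⊆C : D ⊆ C) (C≤D : ∣ C ∣ + ν D ≤ ∣ D ∣ + ν C) where

      R : Subset size
      R = C ∖ D

      W : Subset order
      W = V⟨ C ⟩ ∖ V⟨ D ⟩

      ∣R∣≤∣W∣ : ∣ R ∣ ≤ ∣ W ∣
      ∣R∣≤∣W∣ = +-cancelˡ-≤ (∣ D ∣ + ν D) _ _ (begin
        ∣ D ∣ + ν D + ∣ R ∣     ≡⟨ rearrange (∣ D ∣) (ν D) (∣ R ∣) ⟩
        ∣ D ∣ + ∣ R ∣ + ν D     ≡⟨ cong (_+ ν D) (q⊆p⇒∣p∣≡∣q∣+∣p∖q∣ C D D⊆C) ⟨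
        ∣ C ∣ + ν D             ≤⟨ C≤D ⟩
        ∣ D ∣ + ν C             ≡⟨ cong (∣ D ∣ +_) (q⊆p⇒∣p∣≡∣q∣+∣p∖q∣ V⟨ C ⟩ V⟨ D ⟩ (V⟨⟩-mono D⊆C)) ⟩
        ∣ D ∣ + (ν D + ∣ W ∣)   ≡⟨ +-assoc (∣ D ∣) _ _ ⟨
        ∣ D ∣ + ν D + ∣ W ∣     ∎)
        where
        open ≤-Reasoning
        rearrange : ∀ a b c → a + b + c ≡ a + c + b
        rearrange = solve-∀

      W⊆V∖ : W ⊆ V P ∖ V⟨ C′ ⟩
      W⊆V∖ w∈ with x∈p∖q⁻ V⟨ C ⟩ V⟨ D ⟩ w∈
      ... | w∈C , w∉D with x∈p∪q⁻ V⟨ C′ ⟩ (V P) (subst (_ ∈_) V≡ w∈C)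
      ...   | inj₁ w∈C′ = contradiction (V⟨⟩-mono C′⊆D w∈C′) w∉D
      ...   | inj₂ w∈P  = x∈p∖q⁺ w∈P λ w∈C′ → w∉D (V⟨⟩-mono C′⊆D w∈C′)

      R⊆E : R ⊆ E P
      R⊆E e∈ with x∈p∖q⁻ C D e∈
      ... | e∈C , e∉D with x∈p∪q⁻ C′ (E P) e∈C
      ...   | inj₁ e∈C′ = contradiction (C′⊆D e∈C′) e∉D
      ...   | inj₂ e∈P  = e∈P

      incident-W⇒∈R : ∀ {e w} → e ∈ E P → Incident e w → w ∈ W → e ∈ R
      incident-W⇒∈R e∈ e-w w∈ = x∈p∖q⁺ (x∈p∪q⁺ (inj₂ e∈))
        λ e∈D → proj₂ (x∈p∖q⁻ V⟨ C ⟩ V⟨ D ⟩ w∈) (closed (G ⟨ D ⟩) e∈D e-w)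

      -- Every vertex of W has degree at least 2 in P and only edges of R meet W,
      -- so |R| ≤ |W| leaves no room for an edge of R with an end outside W.
      ends-in-W : ∀ {e} → e ∈ R → src e ∈ W × tgt e ∈ W
      ends-in-W {e} e∈ = 2≤χ+χ⇒∈ W (src e) (tgt e) (begin
        2                                              ≡⟨ cong (_* 2) (χ-∈ e∈) ⟨
        χ R e * 2                                      ≤⟨ sum-squeeze upper total e ⟩
        χ (E P) e * (χ W (src e) + χ W (tgt e))        ≡⟨ cong (_* (χ W (src e) + χ W (tgt e))) (χ-∈ (R⊆E e∈)) ⟩
        1 * (χ W (src e) + χ W (tgt e))                ≡⟨ *-identityˡ _ ⟩
        χ W (src e) + χ W (tgt e)                      ∎)
        where
        open ≤-Reasoning
        upper : ∀ i → χ (E P) i * (χ W (src i) + χ W (tgt i)) ≤ χ R i * 2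
        upper i with i ∈? R
        ... | yes i∈ rewrite χ-∈ i∈ = *-mono-≤ (χ≤1 (E P) i) (+-mono-≤ (χ≤1 W (src i)) (χ≤1 W (tgt i)))
        ... | no i∉ with i ∈? E P
        ...   | no i∉P rewrite χ-∉ i∉P = z≤n
        ...   | yes i∈P rewrite χ-∉ (i∉ ∘ incident-W⇒∈R i∈P (inj₁ refl))
                              | χ-∉ (i∉ ∘ incident-W⇒∈R i∈P (inj₂ refl)) =
          ≤-trans (≤-reflexive (*-zeroʳ (χ (E P) i))) z≤n
        lower : ∀ v → χ W v * 2 ≤ χ W v * degree P v
        lower v with v ∈? W
        ... | no v∉ rewrite χ-∉ v∉ = z≤n
        ... | yes v∈ = let v∈P , v∉C′ = x∈p∖q⁻ (V P) V⟨ C′ ⟩ (W⊆V∖ v∈) in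
          *-monoʳ-≤ (χ W v) (branching v∈P v∉C′)
        total : sum (λ i → χ R i * 2) ≤ sum (λ i → χ (E P) i * (χ W (src i) + χ W (tgt i)))
        total = begin
          sum (λ i → χ R i * 2)                 ≡⟨ sum-χ-*2 R ⟩
          ∣ R ∣ * 2                             ≤⟨ *-monoˡ-≤ 2 ∣R∣≤∣W∣ ⟩
          ∣ W ∣ * 2                             ≡⟨ sum-χ-*2 W ⟨
          sum (λ v → χ W v * 2)                 ≤⟨ sum-mono-≤ lower ⟩
          sum (λ v → χ W v * degree P v)        ≡⟨ double-counting P W ⟩
          sum (λ i → χ (E P) i * (χ W (src i) + χ W (tgt i))) ∎

      -- An edge of `P` at a vertex of `W` is missed by `D`, so its other end is in `W` too: no walk
      -- in `P` can leave `W`.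
      walk-in-W : ∀ {u v} → Walk P u v → u ∈ W → v ∈ W
      walk-in-W ε u∈ = u∈
      walk-in-W (step e e∈ (inj₁ (refl , refl)) ◅ w) u∈ =
        walk-in-W w (proj₂ (ends-in-W (incident-W⇒∈R e∈ (inj₁ refl) u∈)))
      walk-in-W (step e e∈ (inj₂ (refl , refl)) ◅ w) u∈ =
        walk-in-W w (proj₁ (ends-in-W (incident-W⇒∈R e∈ (inj₂ refl) u∈)))

      -- A single missed edge has its ends in `W`, so by connectedness all of `P` is missed. Then
      -- the edges of `P` would be at most as many as its new vertices, contrary to `count`.
      above : C ⊆ D
      above = ⊆-dec-stable C D λ (r , r∈) → contradiction (too-many r∈) (<-irrefl refl)
        where
        V⊆W : ∀ {r} → r ∈ R → V P ⊆ W
        V⊆W r∈ v∈ = walk-in-W (connect (closed P (R⊆E r∈) (inj₁ refl)) v∈) (proj₁ (ends-in-W r∈))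
        too-many : ∀ {r} → r ∈ R → ∣ V P ∖ V⟨ C′ ⟩ ∣ < ∣ V P ∖ V⟨ C′ ⟩ ∣
        too-many r∈ = begin
          suc ∣ V P ∖ V⟨ C′ ⟩ ∣   ≡⟨ count ⟨
          ∣ E P ∣                 ≤⟨ p⊆q⇒∣p∣≤∣q∣ (λ e∈ → incident-W⇒∈R e∈ (inj₁ refl)
                                       (V⊆W r∈ (closed P e∈ (inj₁ refl)))) ⟩
          ∣ R ∣                   ≤⟨ ∣R∣≤∣W∣ ⟩
          ∣ W ∣                   ≤⟨ p⊆q⇒∣p∣≤∣q∣ W⊆V∖ ⟩
          ∣ V P ∖ V⟨ C′ ⟩ ∣       ∎
          where open ≤-Reasoning

    -- Supermodularity is used twice. Since `D ∩ C′` has at most the defect of `C′`, the set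
    -- `D ∪ C′` has at least that of `D`, so `above` makes it all of `C`. Then `D ∩ C′` has at least
    -- the defect of `C′`, and strictness of `C′` puts `C′` inside `D`.
    strict : Strict C′ → Strict C
    strict C′-strict D D⊆C C≤D = C⊆D
      where
      open ≤-Reasoning
      C⊆D∪C′ : C ⊆ D ∪ C′
      C⊆D∪C′ = above (D ∪ C′) (q⊆p∪q D C′) (∪-lub D⊆C (p⊆p∪q (E P)))
        (+-cancelʳ-≤ (∣ D ∩ C′ ∣ + ν C′ + ν D) _ _ (begin
          ∣ C ∣ + ν (D ∪ C′) + (∣ D ∩ C′ ∣ + ν C′ + ν D)
            ≡⟨ shuffle₁ (∣ C ∣) (ν (D ∪ C′)) (∣ D ∩ C′ ∣) (ν C′) (ν D) ⟩
          (∣ C ∣ + ν D) + (∣ D ∩ C′ ∣ + ν C′) + ν (D ∪ C′)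
            ≤⟨ +-monoˡ-≤ _ (+-mono-≤ C≤D (strict⇒defect≤ C′-strict (D ∩ C′) (p∩q⊆q D C′))) ⟩
          (∣ D ∣ + ν C) + (∣ C′ ∣ + ν (D ∩ C′)) + ν (D ∪ C′)
            ≡⟨ shuffle₂ (∣ D ∣) (ν C) (∣ C′ ∣) (ν (D ∩ C′)) (ν (D ∪ C′)) ⟩
          (∣ D ∣ + ∣ C′ ∣) + ν C + (ν (D ∪ C′) + ν (D ∩ C′))
            ≤⟨ +-monoʳ-≤ (∣ D ∣ + ∣ C′ ∣ + ν C) (ν-submodular D C′) ⟩
          (∣ D ∣ + ∣ C′ ∣) + ν C + (ν D + ν C′)
            ≡⟨ cong (λ m → m + ν C + (ν D + ν C′)) (∣p∪q∣+∣p∩q∣ D C′) ⟨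
          (∣ D ∪ C′ ∣ + ∣ D ∩ C′ ∣) + ν C + (ν D + ν C′)
            ≡⟨ shuffle₃ (∣ D ∪ C′ ∣) (∣ D ∩ C′ ∣) (ν C) (ν D) (ν C′) ⟩
          ∣ D ∪ C′ ∣ + ν C + (∣ D ∩ C′ ∣ + ν C′ + ν D) ∎))
        where
        shuffle₁ : ∀ a b c d e → a + b + (c + d + e) ≡ (a + e) + (c + d) + b
        shuffle₁ = solve-∀
        shuffle₂ : ∀ a b c d e → (a + b) + (c + d) + e ≡ (a + c) + b + (e + d)
        shuffle₂ = solve-∀
        shuffle₃ : ∀ a b c d e → (a + b) + c + (d + e) ≡ a + c + (b + e + d)
        shuffle₃ = solve-∀
      D∪C′≡C : D ∪ C′ ≡ C
      D∪C′≡C = ⊆-antisym (∪-lub D⊆C (p⊆p∪q (E P))) C⊆D∪C′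
      C′⊆D : C′ ⊆ D
      C′⊆D e∈ = p∩q⊆p D C′ (C′-strict (D ∩ C′) (p∩q⊆q D C′)
        (+-cancelʳ-≤ (∣ D ∣ + ν C) _ _ (begin
          ∣ C′ ∣ + ν (D ∩ C′) + (∣ D ∣ + ν C)
            ≡⟨ shuffle₁ (∣ C′ ∣) (ν (D ∩ C′)) (∣ D ∣) (ν C) ⟩
          (∣ D ∣ + ∣ C′ ∣) + (ν C + ν (D ∩ C′))
            ≡⟨ cong₂ (λ m S → m + (ν S + ν (D ∩ C′))) (∣p∪q∣+∣p∩q∣ D C′) D∪C′≡C ⟨
          (∣ D ∪ C′ ∣ + ∣ D ∩ C′ ∣) + (ν (D ∪ C′) + ν (D ∩ C′))
            ≤⟨ +-monoʳ-≤ (∣ D ∪ C′ ∣ + ∣ D ∩ C′ ∣) (ν-submodular D C′) ⟩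
          (∣ D ∪ C′ ∣ + ∣ D ∩ C′ ∣) + (ν D + ν C′)
            ≡⟨ cong (λ S → (∣ S ∣ + ∣ D ∩ C′ ∣) + (ν D + ν C′)) D∪C′≡C ⟩
          (∣ C ∣ + ∣ D ∩ C′ ∣) + (ν D + ν C′)
            ≡⟨ shuffle₂ (∣ C ∣) (∣ D ∩ C′ ∣) (ν D) (ν C′) ⟩
          (∣ C ∣ + ν D) + (∣ D ∩ C′ ∣ + ν C′)
            ≤⟨ +-monoˡ-≤ _ C≤D ⟩
          (∣ D ∣ + ν C) + (∣ D ∩ C′ ∣ + ν C′)
            ≡⟨ +-comm (∣ D ∣ + ν C) _ ⟩
          ∣ D ∩ C′ ∣ + ν C′ + (∣ D ∣ + ν C) ∎)) e∈)
        where
        shuffle₁ : ∀ a b c d → a + b + (c + d) ≡ (c + a) + (d + b)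
        shuffle₁ = solve-∀
        shuffle₂ : ∀ a b c d → (a + b) + (c + d) ≡ (a + c) + (b + d)
        shuffle₂ = solve-∀
      C⊆D : C ⊆ D
      C⊆D e∈ = ∪-lub (λ e∈D → e∈D) C′⊆D (C⊆D∪C′ e∈)

  -- Circuits as strict sets

  candidate⁺ : ∀ {k C} → 1 ≤ k → ∣ C ∣ ≡ ν C + k → Candidate G k C
  candidate⁺ {k} {C} 1≤k eq =
    0<∣p∣⇒Nonempty C (≤-trans (≤-trans 1≤k (m≤n+m k (ν C))) (≤-reflexive (sym eq))) , eq

  -- Deleting an edge lowers the defect by at most one, so every smaller defect is attained.
  thin : ∀ {k} m D → ∣ D ∣ ≡ m → ν D + k ≤ m → ∃[ D′ ] (D′ ⊆ D × ∣ D′ ∣ ≡ ν D′ + k)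
  thin {k} m D ∣D∣≡m ≤m with m≤n⇒m<n∨m≡n ≤m
  ... | inj₂ eq = D , ⊆-refl , trans ∣D∣≡m (sym eq)
  thin {k} (suc m) D ∣D∣≡m _ | inj₁ (s≤s <m) =
    let e , e∈ = 0<∣p∣⇒Nonempty D (subst (0 <_) (sym ∣D∣≡m) (s≤s z≤n))
        D-e    = D ∖ ⁅ e ⁆
        D-e⊆D  = p∖q⊆p D ⁅ e ⁆
        D′ , D′⊆ , eq = thin m D-e
          (ℕ.suc-injective (trans (sym (x∈p⇒∣p∣≡1+∣p∖x∣ D e e∈)) ∣D∣≡m))
          (≤-trans (+-monoˡ-≤ k (p⊆q⇒∣p∣≤∣q∣ (V⟨⟩-mono D-e⊆D))) <m)
    in D′ , (λ x∈ → D-e⊆D (D′⊆ x∈)) , eq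

  -- A subset `D` with at least the defect of `C` has defect at least `k`, so `thin` finds a
  -- candidate inside it; by minimality this candidate is already `C`.
  circuit⇒strict : ∀ {k C} → 1 ≤ k → IsCircuit G k C → Strict C
  circuit⇒strict {k} {C} 1≤k ((_ , ∣C∣≡) , minimal) D D⊆C C≤D =
    let D′ , D′⊆D , eq = thin (∣ D ∣) D refl (+-cancelʳ-≤ (ν C) _ _ (begin
          ν D + k + ν C     ≡⟨ rearrange (ν D) k (ν C) ⟩
          ν C + k + ν D     ≡⟨ cong (_+ ν D) ∣C∣≡ ⟨
          ∣ C ∣ + ν D       ≤⟨ C≤D ⟩
          ∣ D ∣ + ν C       ∎))
    in subst (_⊆ D) (minimal D′ (candidate⁺ 1≤k eq) (λ x → D⊆C (D′⊆D x))) D′⊆D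
    where
    open ≤-Reasoning
    rearrange : ∀ a b c → a + b + c ≡ c + b + a
    rearrange = solve-∀

  strict⇒circuit : ∀ {k C} → 1 ≤ k → Strict C → ∣ C ∣ ≡ ν C + k → IsCircuit G k C
  strict⇒circuit {k} {C} 1≤k strict ∣C∣≡ = candidate⁺ 1≤k ∣C∣≡ , λ D (_ , ∣D∣≡) D⊆C →
    ⊆-antisym D⊆C (strict D D⊆C (≤-reflexive (begin
      ∣ C ∣ + ν D         ≡⟨ cong (_+ ν D) ∣C∣≡ ⟩
      ν C + k + ν D       ≡⟨ rearrange (ν C) k (ν D) ⟩
      ν D + k + ν C       ≡⟨ cong (_+ ν C) ∣D∣≡ ⟨
      ∣ D ∣ + ν C         ∎)))
    where
    open ≡-Reasoning
    rearrange : ∀ a b c → a + b + c ≡ c + b + a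
    rearrange = solve-∀

  -- Descent along proper inclusion: with finitely many subsets it is decidable whether a smaller
  -- candidate exists, and if there is none the present one is minimal.
  candidate⇒circuit⊆ : ∀ {k} C → Acc _⊂_ C → Candidate G k C → ∃[ B ] (B ⊆ C × IsCircuit G k B)
  candidate⇒circuit⊆ {k} C (acc rec) candidate
    with anySubset? (λ D → (D ⊂? C) ×-dec (nonempty? D ×-dec (∣ D ∣ ℕ.≟ ν D + k)))
  ... | yes (D , D⊂C , D-candidate) =
    let B , B⊆D , circuit = candidate⇒circuit⊆ D (rec D⊂C) D-candidate
    in B , (λ x∈ → p⊂q⇒p⊆q D⊂C (B⊆D x∈)) , circuit
  ... | no none = C , ⊆-refl , candidate , λ D D-candidate D⊆C →
    ⊆-antisym D⊆C (⊆-dec-stable C D λ (x , x∈) →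
      ⊥-elim (none (D , (D⊆C , x , x∈p∖q⁻ C D x∈) , D-candidate)))

  dense⇒circuit⊆ : ∀ {k} D → 1 ≤ k → ν D + k ≤ ∣ D ∣ → ∃[ B ] (B ⊆ D × IsCircuit G k B)
  dense⇒circuit⊆ D 1≤k dense =
    let D′ , D′⊆D , eq = thin (∣ D ∣) D refl dense
        B , B⊆D′ , circuit = candidate⇒circuit⊆ D′ (⊂-wellFounded D′) (candidate⁺ 1≤k eq)
    in B , (λ x∈ → D′⊆D (B⊆D′ x∈)) , circuit

  -- Deleting the edge at a leaf also loses the leaf, so the defect would not drop.
  strict⇒¬leaf : ∀ {C} → Strict C → ∀ v → ¬ IsLeaf (G ⟨ C ⟩) v
  strict⇒¬leaf {C} C-strict v (v∈ , e , e∈ , e-v , ¬loop , unique) =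
    proj₂ (x∈p∖q⁻ C ⁅ e ⁆ (C-strict D (p∖q⊆p C ⁅ e ⁆) C≤D e∈)) (x∈⁅x⁆ e)
    where
    open ≤-Reasoning
    D : Subset size
    D = C ∖ ⁅ e ⁆
    loses-v : V⟨ D ⟩ ⊆ V⟨ C ⟩ ∖ ⁅ v ⁆
    loses-v w∈ = let f , f∈D , f-w = ∈V⟨⟩⁻ {X = D} w∈
                     f∈C , f∉e = x∈p∖q⁻ C ⁅ e ⁆ f∈D in
      x∈p∖q⁺ (closed (G ⟨ C ⟩) f∈C f-w) λ w∈v →
        f∉e (subst (_∈ ⁅ e ⁆) (sym (unique f f∈C (subst (Incident f) (x∈⁅y⁆⇒x≡y v w∈v) f-w))) (x∈⁅x⁆ e))
    C≤D : ∣ C ∣ + ν D ≤ ∣ D ∣ + ν C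
    C≤D = begin
      ∣ C ∣ + ν D                      ≡⟨ cong (_+ ν D) (x∈p⇒∣p∣≡1+∣p∖x∣ C e e∈) ⟩
      suc (∣ D ∣ + ν D)                ≡⟨ +-suc (∣ D ∣) (ν D) ⟨
      ∣ D ∣ + suc (ν D)                ≤⟨ +-monoʳ-≤ (∣ D ∣) (s≤s (p⊆q⇒∣p∣≤∣q∣ loses-v)) ⟩
      ∣ D ∣ + suc ∣ V⟨ C ⟩ ∖ ⁅ v ⁆ ∣   ≡⟨ cong (∣ D ∣ +_) (x∈p⇒∣p∣≡1+∣p∖x∣ V⟨ C ⟩ v v∈) ⟨
      ∣ D ∣ + ν C                      ∎

  -- Components and bicycles

  Joins-sym : ∀ {e u v} → Joins e u v → Joins e v u
  Joins-sym (inj₁ p) = inj₂ p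
  Joins-sym (inj₂ p) = inj₁ p

  Joins⇒Incidentˡ : ∀ {e u v} → Joins e u v → Incident e u
  Joins⇒Incidentˡ (inj₁ (p , _)) = inj₁ p
  Joins⇒Incidentˡ (inj₂ (_ , p)) = inj₂ p

  Step-sym : ∀ {H : Subgraph G} {u v} → Step H u v → Step H v u
  Step-sym (step e e∈ j) = step e e∈ (Joins-sym j)

  walk-sym : ∀ {H : Subgraph G} {u v} → Walk H u v → Walk H v u
  walk-sym = reverse Step-sym

  walk∈V : ∀ {H : Subgraph G} {u v} → Walk H u v → u ∈ V H → v ∈ V H
  walk∈V ε u∈ = u∈
  walk∈V {H} (step e e∈ j ◅ w) u∈ = walk∈V w (closed H e∈ (Joins⇒Incidentˡ (Joins-sym j)))

  -- While some edge leaves the reached set `S`, its far end is added; this stops because `S` cannot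
  -- grow forever. The result is the component of `u`.
  component : ∀ (H : Subgraph G) {u} S → Acc _⊃_ S → u ∈ S → (∀ {v} → v ∈ S → Walk H u v) →
    ∃[ T ] (u ∈ T × (∀ {v} → v ∈ T → Walk H u v) ×
            (∀ {e x y} → e ∈ E H → Joins e x y → x ∈ T → y ∈ T))
  component H {u} S (acc rec) u∈S reach
    with any? (λ e → (e ∈? E H) ×-dec (((src e ∈? S) ×-dec ¬? (tgt e ∈? S))
                                  ⊎-dec ((tgt e ∈? S) ×-dec ¬? (src e ∈? S))))
  ... | yes (e , e∈ , ends) = component H (S ∪ ⁅ y ⁆)
      (rec (p⊆p∪q ⁅ y ⁆ , y , q⊆p∪q S ⁅ y ⁆ (x∈⁅x⁆ y) , y∉)) (p⊆p∪q ⁅ y ⁆ u∈S)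
      λ v∈ → [ reach , (λ v∈y → subst (Walk H u) (sym (x∈⁅y⁆⇒x≡y y v∈y)) to-y) ]′ (x∈p∪q⁻ S ⁅ y ⁆ v∈)
    where
    exit : (src e ∈ S × tgt e ∉ S) ⊎ (tgt e ∈ S × src e ∉ S) → ∃[ y ] (y ∉ S × Walk H u y)
    exit (inj₁ (x∈ , y∉)) = _ , y∉ , reach x∈ ◅◅ (step e e∈ (inj₁ (refl , refl)) ◅ ε)
    exit (inj₂ (x∈ , y∉)) = _ , y∉ , reach x∈ ◅◅ (step e e∈ (inj₂ (refl , refl)) ◅ ε)
    y    = proj₁ (exit ends)
    y∉   = proj₁ (proj₂ (exit ends))
    to-y = proj₂ (proj₂ (exit ends))
  ... | no none = S , u∈S , reach , S-closed
    where
    S-closed : ∀ {e x y} → e ∈ E H → Joins e x y → x ∈ S → y ∈ S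
    S-closed {e} e∈ (inj₁ (refl , refl)) x∈ =
      decidable-stable (tgt e ∈? S) λ y∉ → none (e , e∈ , inj₁ (x∈ , y∉))
    S-closed {e} e∈ (inj₂ (refl , refl)) x∈ =
      decidable-stable (src e ∈? S) λ y∉ → none (e , e∈ , inj₂ (x∈ , y∉))

  bicycle⇒ear : ∀ {P : Subgraph G} {A} → IsBicycle P → Empty (A ∩ V P) → Ear A P
  bicycle⇒ear {P} {A} ((_ , connect) , ¬leaf , Δ≡1) A∩V≡∅ = record
    { connect   = connect
    ; branching = λ v∈ _ → let e , e∈ , e-v = has-edge v∈ in ¬leaf⇒2≤degree {H = P} (¬leaf _) e∈ e-v
    ; count     = trans ∣E∣≡ (cong suc (cong ∣_∣ (⊆-antisym
        (λ v∈ → x∈p∖q⁺ v∈ λ v∈A → A∩V≡∅ (_ , x∈p∩q⁺ (v∈A , v∈))) (p∖q⊆p (V P) A))))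
    }
    where
    ∣E∣≡ : ∣ E P ∣ ≡ suc ∣ V P ∣
    ∣E∣≡ = m-n≡1⇒m≡1+n Δ≡1
    -- Take any edge `f` and walk from `v` to an end of it: either `v` is that end or the first step
    -- of the walk is an edge at `v`.
    has-edge : ∀ {v} → v ∈ V P → ∃[ e ] (e ∈ E P × Incident e v)
    has-edge v∈ with 0<∣p∣⇒Nonempty (E P) (subst (0 <_) (sym ∣E∣≡) (s≤s z≤n))
    ... | f , f∈ with connect v∈ (closed P f∈ (inj₁ refl))
    ...   | ε               = f , f∈ , inj₁ refl
    ...   | step e e∈ j ◅ _ = e , e∈ , Joins⇒Incidentˡ j

  bicycle⇒circuit : ∀ {C} → IsBicycle (G ⟨ C ⟩) → IsCircuit G 1 C
  bicycle⇒circuit {C} bicycle@(_ , _ , Δ≡1) = strict⇒circuit ≤-refl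
    (subst Strict (∪-identityˡ C) (AddEar.strict {C′ = ⊥} {P = G ⟨ C ⟩}
      (bicycle⇒ear bicycle λ (v , v∈) → let _ , e∈ , _ = ∈V⟨⟩⁻ {X = ⊥} (p∩q⊆p V⟨ ⊥ ⟩ V⟨ C ⟩ v∈) in ∉⊥ e∈)
      (λ (e , e∈) → ∉⊥ (p∩q⊆q C ⊥ e∈)) (V⟨⟩-∪ ⊥ C) (λ D _ _ e∈ → ⊥-elim (∉⊥ e∈))))
    (trans (m-n≡1⇒m≡1+n Δ≡1) (+-comm 1 (ν C)))

  -- Of the component of u and the rest of C one has positive defect, hence is all of C.
  strict⇒connected : ∀ {C} → Strict C → ∣ C ∣ ≡ suc (ν C) →
    ∀ {u v} → u ∈ V⟨ C ⟩ → v ∈ V⟨ C ⟩ → Walk (G ⟨ C ⟩) u v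
  strict⇒connected {C} C-strict ∣C∣≡ {u} {v} u∈ v∈
    with component (G ⟨ C ⟩) ⁅ u ⁆ (⊃-wellFounded ⁅ u ⁆) (x∈⁅x⁆ u)
           (λ v∈u → subst (Walk (G ⟨ C ⟩) u) (sym (x∈⁅y⁆⇒x≡y u v∈u)) ε)
  ... | T , u∈T , reach , T-closed = reach (V⟨X⟩⊆T (V⟨⟩-mono C⊆X v∈))
    where
    open ≤-Reasoning
    inT : Subset size
    inT = select (λ e → src e ∈? T)
    X Y : Subset size
    X = C ∩ inT
    Y = C ∖ inT
    V⟨X⟩⊆T : V⟨ X ⟩ ⊆ T
    V⟨X⟩⊆T w∈ with ∈V⟨⟩⁻ {X = X} w∈
    ... | e , e∈ , e-w with x∈p∩q⁻ C inT e∈ | e-w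
    ...   | e∈C , e∈T | inj₁ refl = ∈-select⁻ (λ e → src e ∈? T) e∈T
    ...   | e∈C , e∈T | inj₂ refl = T-closed e∈C (inj₁ (refl , refl)) (∈-select⁻ (λ e → src e ∈? T) e∈T)
    V⟨Y⟩∩T : ∀ {w} → w ∈ V⟨ Y ⟩ → w ∉ T
    V⟨Y⟩∩T w∈ w∈T with ∈V⟨⟩⁻ {X = Y} w∈
    ... | e , e∈ , e-w with x∈p∖q⁻ C inT e∈ | e-w
    ...   | e∈C , e∉T | inj₁ refl = e∉T (∈-select⁺ (λ e → src e ∈? T) w∈T)
    ...   | e∈C , e∉T | inj₂ refl =
      e∉T (∈-select⁺ (λ e → src e ∈? T) (T-closed e∈C (inj₂ (refl , refl)) w∈T))
    νX+νY≤νC : ν X + ν Y ≤ ν C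
    νX+νY≤νC = begin
      ν X + ν Y                   ≡⟨ ∣p∪q∣-disjoint V⟨ X ⟩ V⟨ Y ⟩ (λ (w , w∈) →
                                       let w∈X , w∈Y = x∈p∩q⁻ V⟨ X ⟩ V⟨ Y ⟩ w∈ in V⟨Y⟩∩T w∈Y (V⟨X⟩⊆T w∈X)) ⟨
      ∣ V⟨ X ⟩ ∪ V⟨ Y ⟩ ∣         ≤⟨ p⊆q⇒∣p∣≤∣q∣ (∪-lub (V⟨⟩-mono (p∩q⊆p C inT)) (V⟨⟩-mono (p∖q⊆p C inT))) ⟩
      ν C                         ∎
    all-of-C : ∀ D → D ⊆ C → ν D < ∣ D ∣ → C ⊆ D
    all-of-C D D⊆C νD<∣D∣ = C-strict D D⊆C (begin
      ∣ C ∣ + ν D                 ≡⟨ cong (_+ ν D) ∣C∣≡ ⟩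
      suc (ν C + ν D)             ≡⟨ +-suc (ν C) (ν D) ⟨
      ν C + suc (ν D)             ≤⟨ +-monoʳ-≤ (ν C) νD<∣D∣ ⟩
      ν C + ∣ D ∣                 ≡⟨ +-comm (ν C) _ ⟩
      ∣ D ∣ + ν C                 ∎)
    C⊆X : C ⊆ X
    C⊆X with ≤-<-connex (∣ X ∣) (ν X)
    ... | inj₂ νX<∣X∣ = all-of-C X (p∩q⊆p C inT) νX<∣X∣
    -- Now `Y` has positive defect and is all of `C`, which would put `u` outside its own component.
    ... | inj₁ ∣X∣≤νX = contradiction u∈T (V⟨Y⟩∩T (V⟨⟩-mono C⊆Y u∈))
      where
      C⊆Y : C ⊆ Y
      C⊆Y = all-of-C Y (p∖q⊆p C inT) (+-cancelˡ-≤ (ν X) _ _ (begin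
        ν X + suc (ν Y)           ≡⟨ +-suc (ν X) (ν Y) ⟩
        suc (ν X + ν Y)           ≤⟨ s≤s νX+νY≤νC ⟩
        suc (ν C)                 ≡⟨ ∣C∣≡ ⟨
        ∣ C ∣                     ≡⟨ ∣p∩q∣+∣p∖q∣≡∣p∣ C inT ⟨
        ∣ X ∣ + ∣ Y ∣             ≤⟨ +-monoˡ-≤ (∣ Y ∣) ∣X∣≤νX ⟩
        ν X + ∣ Y ∣               ∎))

  circuit⇒bicycle : ∀ {C} → IsCircuit G 1 C → IsBicycle (G ⟨ C ⟩)
  circuit⇒bicycle {C} circuit@(((e , e∈) , ∣C∣≡) , _) =
    ((src e , closed (G ⟨ C ⟩) e∈ (inj₁ refl)) , strict⇒connected strict ∣C∣≡suc) ,
    strict⇒¬leaf strict , m≡1+n⇒m-n≡1 ∣C∣≡suc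
    where
    strict : Strict C
    strict = circuit⇒strict ≤-refl circuit
    ∣C∣≡suc : ∣ C ∣ ≡ suc (ν C)
    ∣C∣≡suc = trans ∣C∣≡ (+-comm (ν C) 1)

  -- Walks and paths

  Joins∧Incident : ∀ {e u v w} → Joins e u v → Incident e w → w ≡ u ⊎ w ≡ v
  Joins∧Incident (inj₁ (p , q)) (inj₁ r) = inj₁ (trans (sym r) p)
  Joins∧Incident (inj₁ (p , q)) (inj₂ r) = inj₂ (trans (sym r) q)
  Joins∧Incident (inj₂ (p , q)) (inj₁ r) = inj₂ (trans (sym r) p)
  Joins∧Incident (inj₂ (p , q)) (inj₂ r) = inj₁ (trans (sym r) q)

  Joins∧loop⇒≡ : ∀ {e u v} → Joins e u v → IsLoop e → u ≡ v
  Joins∧loop⇒≡ (inj₁ (refl , refl)) loop = loop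
  Joins∧loop⇒≡ (inj₂ (refl , refl)) loop = sym loop

  module _ {H : Subgraph G} where

    start∈vertices : ∀ {x y} (w : Walk H x y) → x ∈ˡ vertices w
    start∈vertices ε       = here refl
    start∈vertices (_ ◅ _) = here refl

    end∈vertices : ∀ {x y} (w : Walk H x y) → y ∈ˡ vertices w
    end∈vertices ε       = here refl
    end∈vertices (_ ◅ w) = there (end∈vertices w)

    walk-to : ∀ {x y v} (w : Walk H x y) → v ∈ˡ vertices w → Walk H x v
    walk-to ε       (here refl) = ε
    walk-to (s ◅ w) (here refl) = ε
    walk-to (s ◅ w) (there v∈)  = s ◅ walk-to w v∈

    vertices⊆V : ∀ {x y v} (w : Walk H x y) → x ∈ V H → v ∈ˡ vertices w → v ∈ V H
    vertices⊆V w x∈ v∈ = walk∈V (walk-to w v∈) x∈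

    edges⊆E : ∀ {x y e} (w : Walk H x y) → e ∈ˡ edges w → e ∈ E H
    edges⊆E (step _ e∈ _ ◅ w) (here refl) = e∈
    edges⊆E (_ ◅ w)           (there e∈)  = edges⊆E w e∈

    covered⇒connected : ∀ {x y} (w : Walk H x y) → (∀ {v} → v ∈ V H → v ∈ˡ vertices w) →
      ∀ {u v} → u ∈ V H → v ∈ V H → Walk H u v
    covered⇒connected w covers u∈ v∈ = walk-sym (walk-to w (covers u∈)) ◅◅ walk-to w (covers v∈)

    incident∈vertices : ∀ {x y e v} (w : Walk H x y) → e ∈ˡ edges w → Incident e v → v ∈ˡ vertices w
    incident∈vertices (step e _ j ◅ w) (here refl) e-v with Joins∧Incident j e-v
    ... | inj₁ refl = here refl
    ... | inj₂ refl = there (start∈vertices w)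
    incident∈vertices (_ ◅ w) (there e∈) e-v = there (incident∈vertices w e∈ e-v)

    ∣vertices∣≡1+∣edges∣ : ∀ {x y} (w : Walk H x y) → length (vertices w) ≡ suc (length (edges w))
    ∣vertices∣≡1+∣edges∣ ε       = refl
    ∣vertices∣≡1+∣edges∣ (_ ◅ w) = cong suc (∣vertices∣≡1+∣edges∣ w)

    first-edge-new : ∀ {x u y} (s : Step H x u) (w : Walk H u y) → Unique (vertices (s ◅ w)) →
      ∀ {e} → e ∈ˡ edges w → ¬ Incident e x
    first-edge-new s w (x∉ ∷ _) e∈ e-x = All¬⇒¬Any x∉ (incident∈vertices w e∈ e-x)

    first-step-≢ : ∀ {x u y} (s : Step H x u) (w : Walk H u y) → Unique (vertices (s ◅ w)) → x ≢ u
    first-step-≢ s w (x∉ ∷ _) refl = All¬⇒¬Any x∉ (start∈vertices w)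

    unique-edges : ∀ {x y} (w : Walk H x y) → Unique (vertices w) → Unique (edges w)
    unique-edges ε       _              = []
    unique-edges (s ◅ w) u@(_ ∷ unique) =
      ¬Any⇒All¬ _ (λ e∈ → first-edge-new s w u e∈ (Joins⇒Incidentˡ (Step.joins s))) ∷ unique-edges w unique

    edges-¬loop : ∀ {x y e} (w : Walk H x y) → Unique (vertices w) → e ∈ˡ edges w → ¬ IsLoop e
    edges-¬loop (s ◅ w) u           (here refl) loop = first-step-≢ s w u (Joins∧loop⇒≡ (Step.joins s) loop)
    edges-¬loop (s ◅ w) (_ ∷ unique) (there e∈) loop = edges-¬loop w unique e∈ loop

    -- The walk enters and leaves `v` by different edges: the entering edge meets the preceding
    -- vertex, to which the walk never returns.
    interior⇒2≤degree : ∀ {x y v} (w : Walk H x y) → Unique (vertices w) → v ∈ˡ vertices w →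
      v ≢ x → v ≢ y → 2 ≤ degree H v
    interior⇒2≤degree ε _ (here refl) v≢x _ = contradiction refl v≢x
    interior⇒2≤degree (s ◅ w) _ (here refl) v≢x _ = contradiction refl v≢x
    interior⇒2≤degree (s ◅ ε) _ (there (here refl)) _ v≢y = contradiction refl v≢y
    interior⇒2≤degree {v = v} (s ◅ w@(_◅_ {j = u} s′ w′)) unique@(_ ∷ unique′) (there v∈) v≢x v≢y
      with v∈
    ... | here refl = two-edges⇒2≤degree {H = H} (Step.edge∈E s) (Step.edge∈E s′)
      (λ eq → first-edge-new s w unique (here eq) (Joins⇒Incidentˡ (Step.joins s)))
      (Joins⇒Incidentˡ (Joins-sym (Step.joins s))) (Joins⇒Incidentˡ (Step.joins s′))
    ... | there v∈′ = interior⇒2≤degree w unique′ v∈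
      (λ { refl → All¬⇒¬Any (head-∉ unique′) v∈′ }) v≢y
      where
      head-∉ : ∀ {x xs} → Unique (x ∷ xs) → All (x ≢_) xs
      head-∉ (x∉ ∷ _) = x∉

    EndEdge : ∀ {x y} → Walk H x y → Vertex → Set
    EndEdge w v = ∃[ e ] (e ∈ˡ edges w × Incident e v × (∀ {f} → f ∈ˡ edges w → Incident f v → f ≡ e))

    start-edge : ∀ {x y} (w : Walk H x y) → Unique (vertices w) → x ≢ y → EndEdge w x
    start-edge ε _ x≢y = contradiction refl x≢y
    start-edge (s ◅ w) unique _ = Step.edge s , here refl , Joins⇒Incidentˡ (Step.joins s) , λ where
      (here refl) _   → refl
      (there f∈)  f-x → contradiction f-x (first-edge-new s w unique f∈)

    end-edge : ∀ {x y} (w : Walk H x y) → Unique (vertices w) → x ≢ y → EndEdge w y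
    end-edge ε _ x≢y = contradiction refl x≢y
    end-edge (s ◅ ε) _ _ =
      Step.edge s , here refl , Joins⇒Incidentˡ (Joins-sym (Step.joins s)) , λ { (here refl) _ → refl }
    end-edge (s ◅ w@(s′ ◅ w′)) (x∉ ∷ unique′@(u∉ ∷ _)) x≢y
      with end-edge w unique′ (λ { refl → All¬⇒¬Any u∉ (end∈vertices w′) })
    ... | e , e∈ , e-y , only = e , there e∈ , e-y , λ where
      (there f∈)  f-y → only f∈ f-y
      (here refl) f-y → ⊥-elim ([ (λ { refl → x≢y refl }) , (λ { refl → All¬⇒¬Any u∉ (end∈vertices w′) }) ]′
                                   (Joins∧Incident (Step.joins s) f-y))

    EndEdge⇒leaf : ∀ {x y v} (w : Walk H x y) → Unique (vertices w) →
      (∀ {e} → e ∈ E H → e ∈ˡ edges w) → EndEdge w v → IsLeaf H v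
    EndEdge⇒leaf w unique covers (e , e∈ , e-v , only) =
      closed H (edges⊆E w e∈) e-v , e , edges⊆E w e∈ , e-v , edges-¬loop w unique e∈ ,
      λ f f∈ f-v → only (covers f∈) f-v

  module Path {P : Subgraph G} {x y} (path : PathWithEnds P x y) where

    x≢y    = proj₁ path
    w      = proj₁ (proj₂ path)
    unique = proj₁ (proj₂ (proj₂ path))

    V⊆vertices : ∀ {v} → v ∈ V P → v ∈ˡ vertices w
    V⊆vertices = proj₁ (proj₂ (proj₂ (proj₂ path)))

    E⊆edges : ∀ {e} → e ∈ E P → e ∈ˡ edges w
    E⊆edges = proj₂ (proj₂ (proj₂ (proj₂ path)))

    x-leaf : IsLeaf P x
    x-leaf = EndEdge⇒leaf w unique E⊆edges (start-edge w unique x≢y)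

    y-leaf : IsLeaf P y
    y-leaf = EndEdge⇒leaf w unique E⊆edges (end-edge w unique x≢y)

    ∣V∣≡1+∣E∣ : ∣ V P ∣ ≡ suc ∣ E P ∣
    ∣V∣≡1+∣E∣ = trans (∣S∣≡length (vertices w) unique V⊆vertices (vertices⊆V w (proj₁ x-leaf)))
      (trans (∣vertices∣≡1+∣edges∣ w)
      (cong suc (sym (∣S∣≡length (edges w) (unique-edges w unique) E⊆edges (edges⊆E w)))))

    connect : ∀ {u v} → u ∈ V P → v ∈ V P → Walk P u v
    connect = covered⇒connected w V⊆vertices

    branching : ∀ {v} → v ∈ V P → v ≢ x → v ≢ y → 2 ≤ degree P v
    branching v∈ = interior⇒2≤degree w unique (V⊆vertices v∈)

    degree≤1⇒end : ∀ {v} → v ∈ V P → degree P v ≤ 1 → v ∈ ⁅ x ⁆ ∪ ⁅ y ⁆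
    degree≤1⇒end {v} v∈ deg≤1 = decidable-stable (v ∈? (⁅ x ⁆ ∪ ⁅ y ⁆)) λ v∉ →
      <⇒≱ (branching v∈ (λ { refl → v∉ (p⊆p∪q ⁅ y ⁆ (x∈⁅x⁆ x)) })
                        (λ { refl → v∉ (q⊆p∪q ⁅ x ⁆ ⁅ y ⁆ (x∈⁅x⁆ y)) })) deg≤1

  -- The ends are leaves, whereas in any other traversal of `P` the interior vertices have degree at
  -- least 2. Hence the set of ends does not depend on the traversal.
  path-ends-⊆ : ∀ {P : Subgraph G} {x y x′ y′} → PathWithEnds P x y → PathWithEnds P x′ y′ →
    ⁅ x ⁆ ∪ ⁅ y ⁆ ⊆ ⁅ x′ ⁆ ∪ ⁅ y′ ⁆
  path-ends-⊆ {P} {x} {y} {x′} {y′} path path′ v∈ with x∈p∪q⁻ ⁅ x ⁆ ⁅ y ⁆ v∈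
  ... | inj₁ v∈x rewrite x∈⁅y⁆⇒x≡y x v∈x =
    Path.degree≤1⇒end path′ (proj₁ (Path.x-leaf path)) (leaf⇒degree≤1 {H = P} (Path.x-leaf path))
  ... | inj₂ v∈y rewrite x∈⁅y⁆⇒x≡y y v∈y =
    Path.degree≤1⇒end path′ (proj₁ (Path.y-leaf path)) (leaf⇒degree≤1 {H = P} (Path.y-leaf path))

  -- Cycles

  handshake : ∀ (P : Subgraph G) → sum (λ v → χ (V P) v * degree P v) ≡ ∣ E P ∣ * 2
  handshake P = trans (double-counting P (V P))
    (trans (sum-cong-≗ {size} ends) (sum-χ-*2 (E P)))
    where
    ends : ∀ e → χ (E P) e * (χ (V P) (src e) + χ (V P) (tgt e)) ≡ χ (E P) e * 2
    ends e with e ∈? E P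
    ... | no  e∉ rewrite χ-∉ e∉ = refl
    ... | yes e∈ rewrite χ-∈ (closed P e∈ (inj₁ refl)) | χ-∈ (closed P e∈ (inj₂ refl)) = refl

  cycle⇒∣E∣≡∣V∣ : ∀ {P : Subgraph G} → IsCycle P → ∣ E P ∣ ≡ ∣ V P ∣
  cycle⇒∣E∣≡∣V∣ {P} (_ , deg≡2) = *-cancelʳ-≡ _ _ 2
    (trans (sym (handshake P)) (trans (sum-cong-≗ {order} two) (sum-χ-*2 (V P))))
    where
    two : ∀ v → χ (V P) v * degree P v ≡ χ (V P) v * 2
    two v with v ∈? V P
    ... | yes v∈ = cong (χ (V P) v *_) (deg≡2 v∈)
    ... | no  v∉ rewrite χ-∉ v∉ = refl

  -- By the handshake identity the average degree is 2, so a lower bound of 2 at every vertex is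
  -- attained everywhere.
  balanced⇒cycle : ∀ {P : Subgraph G} → Connected P → ∣ E P ∣ ≡ ∣ V P ∣ →
    (∀ {v} → v ∈ V P → 2 ≤ degree P v) → IsCycle P
  balanced⇒cycle {P} connected ∣E∣≡∣V∣ 2≤deg = connected , λ {v} v∈ →
    ≤-antisym (subst (λ c → c * degree P v ≤ c * 2 → degree P v ≤ 2) (sym (χ-∈ v∈))
                 (subst₂ _≤_ (+-identityʳ (degree P v)) refl) (sum-squeeze lower total v))
              (2≤deg v∈)
    where
    lower : ∀ v → χ (V P) v * 2 ≤ χ (V P) v * degree P v
    lower v with v ∈? V P
    ... | yes v∈ = *-monoʳ-≤ (χ (V P) v) (2≤deg v∈)
    ... | no  v∉ rewrite χ-∉ v∉ = z≤n
    total : sum (λ v → χ (V P) v * degree P v) ≤ sum (λ v → χ (V P) v * 2)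
    total = ≤-reflexive (trans (handshake P) (trans (cong (_* 2) ∣E∣≡∣V∣) (sym (sum-χ-*2 (V P)))))

  walk-mono : ∀ {H K : Subgraph G} {u v} → E H ⊆ E K → Walk H u v → Walk K u v
  walk-mono H⊆K = gmap (λ v → v) λ (step e e∈ j) → step e (H⊆K e∈) j

  -- Lollipops

  module Lollipop (P : Subgraph G) {x} (lollipop : LollipopWithEnd P x) where

    K Q : Subgraph G
    K = proj₁ lollipop
    Q = proj₁ (proj₂ lollipop)

    y : Vertex
    y = proj₁ (proj₂ (proj₂ lollipop))

    cycle : IsCycle K
    cycle = proj₁ (proj₂ (proj₂ (proj₂ lollipop)))

    path : PathWithEnds Q y x
    path = proj₁ (proj₂ (proj₂ (proj₂ (proj₂ lollipop))))

    K∩Q : V K ∩ V Q ≡ ⁅ y ⁆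
    K∩Q = proj₁ (proj₂ (proj₂ (proj₂ (proj₂ (proj₂ lollipop)))))

    V≡ : V P ≡ V K ∪ V Q
    V≡ = proj₁ (proj₂ (proj₂ (proj₂ (proj₂ (proj₂ (proj₂ lollipop))))))

    E≡ : E P ≡ E K ∪ E Q
    E≡ = proj₂ (proj₂ (proj₂ (proj₂ (proj₂ (proj₂ (proj₂ lollipop))))))

    EK⊆E : E K ⊆ E P
    EK⊆E e∈ = subst (_ ∈_) (sym E≡) (p⊆p∪q (E Q) e∈)

    EQ⊆E : E Q ⊆ E P
    EQ⊆E e∈ = subst (_ ∈_) (sym E≡) (q⊆p∪q (E K) (E Q) e∈)

    common⇒y : ∀ {v} → v ∈ V K → v ∈ V Q → v ≡ y
    common⇒y v∈K v∈Q = x∈⁅y⁆⇒x≡y y (subst (_ ∈_) K∩Q (x∈p∩q⁺ (v∈K , v∈Q)))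

    y∈ : y ∈ V K × y ∈ V Q
    y∈ = x∈p∩q⁻ (V K) (V Q) (subst (y ∈_) (sym K∩Q) (x∈⁅x⁆ y))

    -- Since `x` differs from `y`, it is not on the cycle; so its only edge is the last edge of the
    -- path.
    x-leaf : IsLeaf P x
    x-leaf = let x∈ , e , e∈ , e-x , ¬loop , only = Path.y-leaf path in
      closed P (EQ⊆E e∈) e-x , e , EQ⊆E e∈ , e-x , ¬loop , λ f f∈ f-x →
        [ (λ f∈K → contradiction (sym (common⇒y (closed K f∈K f-x) x∈)) (Path.x≢y path))
        , (λ f∈Q → only f f∈Q f-x) ]′ (x∈p∪q⁻ (E K) (E Q) (subst (f ∈_) E≡ f∈))

    to-y : ∀ {v} → v ∈ V P → Walk P v y
    to-y v∈ with x∈p∪q⁻ (V K) (V Q) (subst (_ ∈_) V≡ v∈)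
    ... | inj₁ v∈K = walk-mono EK⊆E (proj₂ (proj₁ cycle) v∈K (proj₁ y∈))
    ... | inj₂ v∈Q = walk-mono EQ⊆E (Path.connect path v∈Q (proj₂ y∈))

    -- Vertices of the cycle have degree 2 already in `K`; a vertex of `Q` outside `K` is not `y`,
    -- so apart from `x` it is interior to the path.
    branching : ∀ {v} → v ∈ V P → v ≢ x → 2 ≤ degree P v
    branching {v} v∈ v≢x with v ∈? V K | x∈p∪q⁻ (V K) (V Q) (subst (_ ∈_) V≡ v∈)
    ... | yes v∈K | _ = ≤-trans (≤-reflexive (sym (proj₂ cycle v∈K))) (degree-mono {H = K} {K = P} v EK⊆E)
    ... | no v∉K | inj₁ v∈K = contradiction v∈K v∉K
    ... | no v∉K | inj₂ v∈Q = ≤-trans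
      (Path.branching path v∈Q (λ { refl → v∉K (proj₁ y∈) }) v≢x) (degree-mono {H = Q} {K = P} v EQ⊆E)

    ∣E∣≡∣V∣ : ∣ E P ∣ ≡ ∣ V P ∣
    ∣E∣≡∣V∣ = suc-injective (begin
      suc ∣ E P ∣                              ≡⟨ cong (suc ∘ ∣_∣) E≡ ⟩
      suc ∣ E K ∪ E Q ∣                        ≡⟨ cong suc (∣p∪q∣-disjoint (E K) (E Q) no-common-edge) ⟩
      suc (∣ E K ∣ + ∣ E Q ∣)                  ≡⟨ +-suc (∣ E K ∣) (∣ E Q ∣) ⟨
      ∣ E K ∣ + suc ∣ E Q ∣                    ≡⟨ cong₂ _+_ (cycle⇒∣E∣≡∣V∣ {K} cycle) (sym (Path.∣V∣≡1+∣E∣ path)) ⟩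
      ∣ V K ∣ + ∣ V Q ∣                        ≡⟨ ∣p∪q∣+∣p∩q∣ (V K) (V Q) ⟨
      ∣ V K ∪ V Q ∣ + ∣ V K ∩ V Q ∣            ≡⟨ cong₂ _+_ (cong ∣_∣ (sym V≡)) (trans (cong ∣_∣ K∩Q) (∣⁅x⁆∣≡1 y)) ⟩
      ∣ V P ∣ + 1                              ≡⟨ +-comm (∣ V P ∣) 1 ⟩
      suc ∣ V P ∣                              ∎)
      where
      open ≡-Reasoning
      -- Both ends of a common edge would be `y`, but a path contains no loop.
      no-common-edge : Empty (E K ∩ E Q)
      no-common-edge (e , e∈) = let e∈K , e∈Q = x∈p∩q⁻ (E K) (E Q) e∈ in
        edges-¬loop (Path.w path) (Path.unique path) (Path.E⊆edges path e∈Q)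
          (trans (common⇒y (closed K e∈K (inj₁ refl)) (closed Q e∈Q (inj₁ refl)))
            (sym (common⇒y (closed K e∈K (inj₂ refl)) (closed Q e∈Q (inj₂ refl)))))

  -- Attaching

  -- The nested product has the same shape as the end of the tuple in the theorem, so the two agree
  -- definitionally. Ends are quantified over all presentations of `P` as a path or lollipop.
  Attached : Subset order → Subgraph G → Set
  Attached A P =
    (IsPath P ⊎ IsCycle P ⊎ IsLollipop P ⊎ IsBicycle P) ×
    (∀ x → LollipopWithEnd P x → A ∩ V P ≡ ⁅ x ⁆) ×
    (∀ x y → PathWithEnds P x y → A ∩ V P ≡ ⁅ x ⁆ ∪ ⁅ y ⁆) ×
    (IsCycle P → ∣ A ∩ V P ∣ ≡ 1) ×
    (IsBicycle P → Empty (A ∩ V P))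

  module _ {P : Subgraph G} where

    -- Edges minus vertices is -1 for a path, 0 for a cycle or a lollipop and 1 for a bicycle. This
    -- separates the kinds, except that a lollipop is told from a cycle by its leaf.
    path⇒¬balanced : ∀ {x y} → PathWithEnds P x y → ∣ E P ∣ ≢ ∣ V P ∣
    path⇒¬balanced path eq = 1+n≢n (trans (sym (Path.∣V∣≡1+∣E∣ path)) (sym eq))

    bicycle⇒¬balanced : IsBicycle P → ∣ E P ∣ ≢ ∣ V P ∣
    bicycle⇒¬balanced (_ , _ , Δ≡1) eq = 1+n≢n (trans (sym (m-n≡1⇒m≡1+n Δ≡1)) eq)

    path⇒¬bicycle : ∀ {x y} → PathWithEnds P x y → ¬ IsBicycle P
    path⇒¬bicycle path (_ , _ , Δ≡1) = m≢1+n+m _ {1}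
      (trans (m-n≡1⇒m≡1+n Δ≡1) (cong suc (Path.∣V∣≡1+∣E∣ path)))

    lollipop⇒¬cycle : ∀ {x} → LollipopWithEnd P x → ¬ IsCycle P
    lollipop⇒¬cycle lollipop (_ , deg≡2) = let leaf = Lollipop.x-leaf P lollipop in
      1+n≰n (≤-trans (≤-reflexive (sym (deg≡2 (proj₁ leaf)))) (leaf⇒degree≤1 {H = P} leaf))

    -- The end of one presentation is a leaf, while in the other every vertex except the end has
    -- degree at least 2.
    lollipop-end-unique : ∀ {x x′} → LollipopWithEnd P x → LollipopWithEnd P x′ → x ≡ x′
    lollipop-end-unique {x} {x′} lollipop lollipop′ = decidable-stable (x ≟ x′) λ x≢x′ →
      let leaf = Lollipop.x-leaf P lollipop in
      1+n≰n (≤-trans (Lollipop.branching P lollipop′ (proj₁ leaf) x≢x′) (leaf⇒degree≤1 {H = P} leaf))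

  module _ {A : Subset order} {P : Subgraph G} where

    -- Here `m` is the number of vertices of attachment: 2 for a path, 1 for a cycle or a lollipop.
    excess⇒count : ∀ {m} → ∣ A ∩ V P ∣ ≡ m → m + ∣ E P ∣ ≡ suc ∣ V P ∣ → ∣ E P ∣ ≡ suc ∣ V P ∖ A ∣
    excess⇒count {m} refl eq = +-cancelˡ-≡ m _ _ (begin
      m + ∣ E P ∣                              ≡⟨ eq ⟩
      suc ∣ V P ∣                              ≡⟨ cong suc (∣p∩q∣+∣p∖q∣≡∣p∣ (V P) A) ⟨
      suc (∣ V P ∩ A ∣ + ∣ V P ∖ A ∣)          ≡⟨ cong (λ S → suc (∣ S ∣ + ∣ V P ∖ A ∣)) (∩-comm (V P) A) ⟩
      suc (m + ∣ V P ∖ A ∣)                    ≡⟨ +-suc m _ ⟨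
      m + suc ∣ V P ∖ A ∣                      ∎)
      where open ≡-Reasoning

    ∉⇒≢ : ∀ {x v S} → A ∩ V P ≡ S → x ∈ S → v ∉ A → v ≢ x
    ∉⇒≢ A∩V≡S x∈S v∉A refl = v∉A (p∩q⊆p A (V P) (subst (_ ∈_) (sym A∩V≡S) x∈S))

    attached⇒ear : Attached A P → Ear A P
    attached⇒ear (inj₁ (x , y , path) , _ , ends , _) = record
      { connect   = Path.connect path
      ; branching = λ v∈ v∉A → Path.branching path v∈
          (∉⇒≢ A∩V (p⊆p∪q ⁅ y ⁆ (x∈⁅x⁆ x)) v∉A) (∉⇒≢ A∩V (q⊆p∪q ⁅ x ⁆ ⁅ y ⁆ (x∈⁅x⁆ y)) v∉A)
      ; count     = excess⇒count (trans (cong ∣_∣ A∩V) (∣⁅x⁆∪⁅y⁆∣≡2 (Path.x≢y path)))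
                                 (cong suc (sym (Path.∣V∣≡1+∣E∣ path)))
      }
      where A∩V = ends x y path
    attached⇒ear (inj₂ (inj₁ cycle@((_ , connect) , deg≡2)) , _ , _ , one , _) = record
      { connect   = connect
      ; branching = λ v∈ _ → ≤-reflexive (sym (deg≡2 v∈))
      ; count     = excess⇒count (one cycle) (cong suc (cycle⇒∣E∣≡∣V∣ {P} cycle))
      }
    attached⇒ear (inj₂ (inj₂ (inj₁ (x , lollipop))) , end , _) = record
      { connect   = λ u∈ v∈ → Lollipop.to-y P lollipop u∈ ◅◅ walk-sym (Lollipop.to-y P lollipop v∈)
      ; branching = λ v∈ v∉A → Lollipop.branching P lollipop v∈ (∉⇒≢ A∩V (x∈⁅x⁆ x) v∉A)
      ; count     = excess⇒count (trans (cong ∣_∣ A∩V) (∣⁅x⁆∣≡1 x)) (cong suc (Lollipop.∣E∣≡∣V∣ P lollipop))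
      }
      where A∩V = end x lollipop
    attached⇒ear (inj₂ (inj₂ (inj₂ bicycle)) , _ , _ , _ , disjoint) = bicycle⇒ear bicycle (disjoint bicycle)

    -- The kinds exclude one another, so the clauses for the other three hold vacuously; the clause
    -- for paths follows because the set of ends is well defined.
    path⇒attached : ∀ {x y} → PathWithEnds P x y → A ∩ V P ≡ ⁅ x ⁆ ∪ ⁅ y ⁆ → Attached A P
    path⇒attached path A∩V = inj₁ (_ , _ , path) ,
      (λ _ lollipop → contradiction (Lollipop.∣E∣≡∣V∣ P lollipop) (path⇒¬balanced path)) ,
      (λ _ _ path′ → trans A∩V (⊆-antisym (path-ends-⊆ path path′) (path-ends-⊆ path′ path))) ,
      (λ cycle → contradiction (cycle⇒∣E∣≡∣V∣ {P} cycle) (path⇒¬balanced path)) ,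
      (λ bicycle → contradiction bicycle (path⇒¬bicycle path))

    cycle⇒attached : IsCycle P → ∣ A ∩ V P ∣ ≡ 1 → Attached A P
    cycle⇒attached cycle one = inj₂ (inj₁ cycle) ,
      (λ _ lollipop → contradiction cycle (lollipop⇒¬cycle {P} lollipop)) ,
      (λ _ _ path → contradiction (cycle⇒∣E∣≡∣V∣ {P} cycle) (path⇒¬balanced path)) ,
      (λ _ → one) ,
      (λ bicycle → contradiction (cycle⇒∣E∣≡∣V∣ {P} cycle) (bicycle⇒¬balanced bicycle))

    lollipop⇒attached : ∀ {x} → LollipopWithEnd P x → A ∩ V P ≡ ⁅ x ⁆ → Attached A P
    lollipop⇒attached lollipop A∩V = inj₂ (inj₂ (inj₁ (_ , lollipop))) ,
      (λ _ lollipop′ → trans A∩V (cong ⁅_⁆ (lollipop-end-unique {P} lollipop lollipop′))) ,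
      (λ _ _ path → contradiction (Lollipop.∣E∣≡∣V∣ P lollipop) (path⇒¬balanced path)) ,
      (λ cycle → contradiction cycle (lollipop⇒¬cycle {P} lollipop)) ,
      (λ bicycle → contradiction (Lollipop.∣E∣≡∣V∣ P lollipop) (bicycle⇒¬balanced bicycle))

    bicycle⇒attached : IsBicycle P → Empty (A ∩ V P) → Attached A P
    bicycle⇒attached bicycle disjoint = inj₂ (inj₂ (inj₂ bicycle)) ,
      (λ _ lollipop → contradiction (Lollipop.∣E∣≡∣V∣ P lollipop) (bicycle⇒¬balanced bicycle)) ,
      (λ _ _ path → contradiction bicycle (path⇒¬bicycle path)) ,
      (λ cycle → contradiction (cycle⇒∣E∣≡∣V∣ {P} cycle) (bicycle⇒¬balanced bicycle)) ,
      (λ _ → disjoint)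

  -- Subgraphs traversed by a walk

  -- A walk carries proofs that its edges lie in the host subgraph, so it must be rebuilt in `K`;
  -- the list equations let facts about it be reused.
  transport : ∀ {H K : Subgraph G} {x y} (w : Walk H x y) → (∀ {e} → e ∈ˡ edges w → e ∈ E K) →
    Σ[ w′ ∈ Walk K x y ] (vertices w′ ≡ vertices w × edges w′ ≡ edges w)
  transport ε _ = ε , refl , refl
  transport (step e _ j ◅ w) edges⊆ = let w′ , vs≡ , es≡ = transport w (edges⊆ ∘ there) in
    step e (edges⊆ (here refl)) j ◅ w′ , cong (_ ∷_) vs≡ , cong (e ∷_) es≡

  V⟨edges⟩⊆vertices : ∀ {H : Subgraph G} {x y v} (w : Walk H x y) →
    v ∈ V⟨ fromList (edges w) ⟩ → v ∈ˡ vertices w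
  V⟨edges⟩⊆vertices w v∈ = let e , e∈ , e-v = ∈V⟨⟩⁻ {X = fromList (edges w)} v∈ in
    incident∈vertices w (∈-fromList⁻ e∈) e-v

  walk⇒path : ∀ {H : Subgraph G} {x y} (w : Walk H x y) → Unique (vertices w) → x ≢ y →
    PathWithEnds (G ⟨ fromList (edges w) ⟩) x y
  walk⇒path w unique x≢y = let w′ , vs≡ , es≡ = transport w ∈-fromList⁺ in
    x≢y , w′ , subst Unique (sym vs≡) unique ,
    (λ v∈ → subst (_ ∈ˡ_) (sym vs≡) (V⟨edges⟩⊆vertices w v∈)) ,
    (λ e∈ → subst (_ ∈ˡ_) (sym es≡) (∈-fromList⁻ e∈))

  module _ {H : Subgraph G} {u z g} (w : Walk H u z) (unique : Unique (vertices w))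
           (g∉ : g ∉ˡ edges w) (joins : Joins g u z) where

    V⟨g∷edges⟩⊆vertices : ∀ {v} → v ∈ V⟨ fromList (g ∷ edges w) ⟩ → v ∈ˡ vertices w
    V⟨g∷edges⟩⊆vertices v∈ with ∈V⟨⟩⁻ {X = fromList (g ∷ edges w)} v∈
    ... | e , e∈ , e-v with ∈-fromList⁻ {xs = g ∷ edges w} e∈
    ...   | there e∈w = incident∈vertices w e∈w e-v
    ...   | here refl with Joins∧Incident joins e-v
    ...     | inj₁ refl = start∈vertices w
    ...     | inj₂ refl = end∈vertices w

    -- The walk has one vertex more than it has edges, and `g` makes up the difference. At the two
    -- ends `g` is the second edge; if they coincide, `g` is a loop.
    closed-walk⇒cycle : IsCycle (G ⟨ fromList (g ∷ edges w) ⟩)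
    closed-walk⇒cycle with transport {K = G ⟨ fromList (g ∷ edges w) ⟩} w (∈-fromList⁺ ∘ there)
    ... | w′ , vs≡ , es≡ = balanced⇒cycle ((u , u∈) , covered⇒connected w′ covers) ∣E∣≡∣V∣ 2≤degree
      where
      K : Subgraph G
      K = G ⟨ fromList (g ∷ edges w) ⟩
      g∈ : g ∈ E K
      g∈ = ∈-fromList⁺ {xs = g ∷ edges w} (here refl)
      u∈ : u ∈ V K
      u∈ = closed K g∈ (Joins⇒Incidentˡ joins)
      unique′ : Unique (vertices w′)
      unique′ = subst Unique (sym vs≡) unique
      covers : ∀ {v} → v ∈ V K → v ∈ˡ vertices w′
      covers v∈ = subst (_ ∈ˡ_) (sym vs≡) (V⟨g∷edges⟩⊆vertices v∈)
      ∣E∣≡∣V∣ : ∣ E K ∣ ≡ ∣ V K ∣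
      ∣E∣≡∣V∣ = begin
        ∣ E K ∣                     ≡⟨ ∣fromList∣ (¬Any⇒All¬ _ g∉ ∷ unique-edges w unique) ⟩
        suc (length (edges w))      ≡⟨ ∣vertices∣≡1+∣edges∣ w ⟨
        length (vertices w)         ≡⟨ cong length vs≡ ⟨
        length (vertices w′)        ≡⟨ ∣S∣≡length (vertices w′) unique′ covers (vertices⊆V w′ u∈) ⟨
        ∣ V K ∣                     ∎
        where open ≡-Reasoning
      end-degree : ∀ {v} → EndEdge w′ v → Incident g v → 2 ≤ degree K v
      end-degree (e , e∈ , e-v , _) g-v = two-edges⇒2≤degree {H = K} g∈ (edges⊆E w′ e∈)
        (λ { refl → g∉ (subst (g ∈ˡ_) es≡ e∈) }) g-v e-v
      2≤degree : ∀ {v} → v ∈ V K → 2 ≤ degree K v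
      2≤degree {v} v∈ with u ≟ z | v ≟ u | v ≟ z
      ... | no u≢z | yes refl | _        = end-degree (start-edge w′ unique′ u≢z) (Joins⇒Incidentˡ joins)
      ... | no u≢z | no _     | yes refl = end-degree (end-edge w′ unique′ u≢z) (Joins⇒Incidentˡ (Joins-sym joins))
      ... | _      | no v≢u   | no v≢z   = interior⇒2≤degree w′ unique′ (covers v∈) v≢u v≢z
      ... | yes refl | yes refl | _      = loop⇒2≤degree {H = K} g∈ loop (Joins⇒Incidentˡ joins)
        where
        loop : IsLoop g
        loop = [ (λ (p , q) → trans p (sym q)) , (λ (p , q) → trans p (sym q)) ]′ joins
      ... | yes refl | no v≢u | yes v≡z  = contradiction v≡z v≢u

  -- In a lollipop `before` will be closed to the cycle and `after` will be the path; `common` says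
  -- that they share only `z`.
  record Split {H : Subgraph G} {x y} (w : Walk H x y) (z : Vertex) : Set where
    field
      before   : Walk H x z
      after    : Walk H z y
      unique₁  : Unique (vertices before)
      unique₂  : Unique (vertices after)
      common   : ∀ {v} → v ∈ˡ vertices before → v ∈ˡ vertices after → v ≡ z
      vertices₁ : ∀ {v} → v ∈ˡ vertices before → v ∈ˡ vertices w
      vertices₂ : ∀ {v} → v ∈ˡ vertices after → v ∈ˡ vertices w
      edges₁    : ∀ {e} → e ∈ˡ edges before → e ∈ˡ edges w
      edges₂    : ∀ {e} → e ∈ˡ edges after → e ∈ˡ edges w

  first-step : ∀ {H : Subgraph G} {x y z} (w : Walk H x y) → z ∈ˡ vertices w →
    z ≡ x ⊎ ∃[ u ] Σ[ s ∈ Step H x u ] Σ[ w′ ∈ Walk H u y ] (w ≡ s ◅ w′ × z ∈ˡ vertices w′)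
  first-step ε       (here refl) = inj₁ refl
  first-step (s ◅ w) (here refl) = inj₁ refl
  first-step (s ◅ w) (there z∈)  = inj₂ (_ , s , w , refl , z∈)

  split : ∀ {H : Subgraph G} {x y z} (w : Walk H x y) → Unique (vertices w) → z ∈ˡ vertices w → Split w z
  split w unique z∈ with first-step w z∈
  ... | inj₁ refl = record
    { before = ε ; after = w ; unique₁ = All.[] ∷ [] ; unique₂ = unique
    ; common = λ { (here refl) _ → refl }
    ; vertices₁ = λ { (here refl) → z∈ } ; vertices₂ = λ v∈ → v∈
    ; edges₁ = λ () ; edges₂ = λ e∈ → e∈ }
  split (s ◅ w) (x∉ ∷ unique) _ | inj₂ (_ , _ , _ , refl , z∈) = record
    { before = s ◅ before ; after = after
    ; unique₁ = ¬Any⇒All¬ _ (λ x∈ → All¬⇒¬Any x∉ (vertices₁ x∈)) ∷ unique₁ ; unique₂ = unique₂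
    ; common = λ { (here refl) x∈ → contradiction (vertices₂ x∈) (All¬⇒¬Any x∉)
                 ; (there v∈) v∈′ → common v∈ v∈′ }
    ; vertices₁ = λ { (here refl) → here refl ; (there v∈) → there (vertices₁ v∈) }
    ; vertices₂ = there ∘ vertices₂
    ; edges₁ = λ { (here refl) → here refl ; (there e∈) → there (edges₁ e∈) }
    ; edges₂ = there ∘ edges₂ }
    where open Split (split w unique z∈)

  -- Ears inside a strict set

  module _ (C C′ : Subset size) where

    A : Subset order
    A = V⟨ C′ ⟩

    R : Subset size
    R = C ∖ C′

    EarInside : Set
    EarInside = ∃[ Y ] (Y ⊆ R × Attached A (G ⟨ Y ⟩))

    module _ {u x} (w : Walk (G ⟨ R ⟩) u x) (unique : Unique (vertices w)) (x∈A : x ∈ A)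
             (only-x : ∀ {v} → v ∈ˡ vertices w → v ∈ A → v ≡ x)
             {g z} (g∈ : g ∈ R) (g∉ : g ∉ˡ edges w) (joins : Joins g u z) where

      -- The trail has met itself. The edge `g` closes the piece from `u` to `z` into a cycle;
      -- unless `z` is `x`, the remainder from `z` to `x` completes a lollipop.
      close-up : z ∈ˡ vertices w → EarInside
      close-up z∈ = go (z ≟ x)
        where
        open Split (split w unique z∈)
        X Z : Subset size
        X = fromList (g ∷ edges before)
        Z = fromList (edges after)
        X⊆R : X ⊆ R
        X⊆R e∈ with ∈-fromList⁻ {xs = g ∷ edges before} e∈
        ... | here refl = g∈
        ... | there e∈′ = edges⊆E before e∈′
        Z⊆R : Z ⊆ R
        Z⊆R e∈ = edges⊆E after (∈-fromList⁻ {xs = edges after} e∈)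
        z∈V⟨X⟩ : z ∈ V⟨ X ⟩
        z∈V⟨X⟩ = closed (G ⟨ X ⟩) (∈-fromList⁺ {xs = g ∷ edges before} (here refl)) (Joins⇒Incidentˡ (Joins-sym joins))
        g∉before : g ∉ˡ edges before
        g∉before = g∉ ∘ edges₁
        V⟨X⟩⊆ : ∀ {v} → v ∈ V⟨ X ⟩ → v ∈ˡ vertices before
        V⟨X⟩⊆ = V⟨g∷edges⟩⊆vertices before unique₁ g∉before joins
        cycle : IsCycle (G ⟨ X ⟩)
        cycle = closed-walk⇒cycle before unique₁ g∉before joins
        go : Dec (z ≡ x) → EarInside
        go (yes refl) = X , X⊆R , cycle⇒attached cycle (trans
          (cong ∣_∣ (p∩q≡⁅x⁆ x∈A z∈V⟨X⟩ λ v∈A v∈X → only-x (vertices₁ (V⟨X⟩⊆ v∈X)) v∈A)) (∣⁅x⁆∣≡1 x))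
        go (no z≢x) = X ∪ Z , ∪-lub X⊆R Z⊆R , lollipop⇒attached
          (G ⟨ X ⟩ , G ⟨ Z ⟩ , z , cycle , path ,
            p∩q≡⁅x⁆ z∈V⟨X⟩ (proj₁ (Path.x-leaf path))
              (λ v∈X v∈Z → common (V⟨X⟩⊆ v∈X) (V⟨edges⟩⊆vertices after v∈Z)) ,
            V⟨⟩-∪ X Z , refl)
          (p∩q≡⁅x⁆ x∈A (V⟨⟩-mono (q⊆p∪q X Z) (proj₁ (Path.y-leaf path))) λ v∈A v∈ →
            only-x ([ (λ v∈X → vertices₁ (V⟨X⟩⊆ v∈X)) , (λ v∈Z → vertices₂ (V⟨edges⟩⊆vertices after v∈Z)) ]′
              (x∈p∪q⁻ V⟨ X ⟩ V⟨ Z ⟩ (subst (_ ∈_) (V⟨⟩-∪ X Z) v∈))) v∈A)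
          where
          path : PathWithEnds (G ⟨ Z ⟩) z x
          path = walk⇒path after unique₂ z≢x

      longer : Walk (G ⟨ R ⟩) z x
      longer = step g g∈ (Joins-sym joins) ◅ w

      longer-unique : z ∉ˡ vertices w → Unique (vertices longer)
      longer-unique z∉ = ¬Any⇒All¬ _ z∉ ∷ unique

      cross : z ∉ˡ vertices w → z ∈ A → EarInside
      cross z∉ z∈A = Y , (λ e∈ → edges⊆E longer (∈-fromList⁻ {xs = edges longer} e∈)) , path⇒attached path
        (⊆-antisym fwd (∪-lub (single z∈A (proj₁ (Path.x-leaf path))) (single x∈A (proj₁ (Path.y-leaf path)))))
        where
        Y : Subset size
        Y = fromList (edges longer)
        path : PathWithEnds (G ⟨ Y ⟩) z x
        path = walk⇒path longer (longer-unique z∉) λ { refl → z∉ (end∈vertices w) }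
        single : ∀ {v} → v ∈ A → v ∈ V⟨ Y ⟩ → ⁅ v ⁆ ⊆ A ∩ V⟨ Y ⟩
        single {v} v∈A v∈Y v′∈ = subst (_∈ A ∩ V⟨ Y ⟩) (sym (x∈⁅y⁆⇒x≡y v v′∈)) (x∈p∩q⁺ (v∈A , v∈Y))
        fwd : A ∩ V⟨ Y ⟩ ⊆ ⁅ z ⁆ ∪ ⁅ x ⁆
        fwd v∈ with x∈p∩q⁻ A V⟨ Y ⟩ v∈
        ... | v∈A , v∈Y with V⟨edges⟩⊆vertices longer v∈Y
        ...   | here refl = p⊆p∪q ⁅ x ⁆ (x∈⁅x⁆ z)
        ...   | there v∈w = q⊆p∪q ⁅ z ⁆ ⁅ x ⁆ (subst (_∈ ⁅ x ⁆) (sym (only-x v∈w v∈A)) (x∈⁅x⁆ x))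

      -- The edge `g` is no loop, as `u` is on the trail and `z` is not; so `z`, not being a leaf,
      -- has another edge `f` in `C`. It avoids `C′` because `z` is outside `A`, and avoids the
      -- trail because `z` is new.
      next-edge : (∀ v → ¬ IsLeaf (G ⟨ C ⟩) v) → z ∉ˡ vertices w → z ∉ A →
        ∃[ f ] ∃[ z′ ] (f ∈ R × f ∉ˡ edges longer × Joins f z z′)
      next-edge ¬leaf z∉ z∉A with any? (λ f → (f ∈? C) ×-dec (incident? f z ×-dec ¬? (f ≟ g)))
      ... | no none = contradiction
        (closed (G ⟨ C ⟩) {e = g} (p∖q⊆p C C′ g∈) (Joins⇒Incidentˡ (Joins-sym joins)) ,
         g , p∖q⊆p C C′ g∈ , Joins⇒Incidentˡ (Joins-sym joins) ,
         (λ loop → z∉ (subst (_∈ˡ vertices w) (Joins∧loop⇒≡ joins loop) (start∈vertices w))) ,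
         λ f f∈ f-z → decidable-stable (f ≟ g) λ f≢g → none (f , f∈ , f-z , f≢g)) (¬leaf z)
      ... | yes (f , f∈C , f-z , f≢g) =
        f , proj₁ (other-end f-z) , x∈p∖q⁺ f∈C (λ f∈C′ → z∉A (closed (G ⟨ C′ ⟩) f∈C′ f-z)) ,
        (λ { (here f≡g) → f≢g f≡g ; (there f∈w) → z∉ (incident∈vertices w f∈w f-z) }) ,
        proj₂ (other-end f-z)
        where
        other-end : Incident f z → ∃[ z′ ] Joins f z z′
        other-end (inj₁ p) = tgt f , inj₁ (p , refl)
        other-end (inj₂ p) = src f , inj₂ (refl , p)

    -- The number `n` bounds the steps still possible, since each extension adds a new vertex to the
    -- trail.
    grow : (∀ v → ¬ IsLeaf (G ⟨ C ⟩) v) → ∀ n {u x} (w : Walk (G ⟨ R ⟩) u x) → Unique (vertices w) →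
      order < n + length (vertices w) → x ∈ A → (∀ {v} → v ∈ˡ vertices w → v ∈ A → v ≡ x) →
      ∀ {g z} → g ∈ R → g ∉ˡ edges w → Joins g u z → EarInside
    -- The trail would have more distinct vertices than the graph.
    grow ¬leaf zero w unique bound _ _ _ _ _ = contradiction
      (≤-trans bound (≤-trans (≤-reflexive (sym (∣fromList∣ unique))) (∣p∣≤n (fromList (vertices w))))) 1+n≰n
    grow ¬leaf (suc n) w unique bound x∈A only-x {g} {z} g∈ g∉ joins
      with member? _≟_ z (vertices w) | z ∈? A
    ... | yes z∈ | _       = close-up w unique x∈A only-x g∈ g∉ joins z∈
    ... | no z∉  | yes z∈A = cross w unique x∈A only-x g∈ g∉ joins z∉ z∈A
    ... | no z∉  | no z∉A  =
      let _ , _ , f∈ , f∉ , f-joins = next-edge w unique x∈A only-x g∈ g∉ joins ¬leaf z∉ z∉A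
      in grow ¬leaf n (longer w unique x∈A only-x g∈ g∉ joins)
           (longer-unique w unique x∈A only-x g∈ g∉ joins z∉)
           (subst (order <_) (sym (+-suc n _)) bound) x∈A
           (λ { (here refl) v∈A → contradiction v∈A z∉A ; (there v∈) v∈A → only-x v∈ v∈A })
           f∈ f∉ f-joins

    -- By strictness `C` has larger defect than `C′`. With no common vertex, `C′` and `R` have at
    -- most `ν C` vertices together, so the gain in defect must come from `R`.
    rest-dense : Strict C → C′ ⊆ C → ¬ C ⊆ C′ → Empty (A ∩ V⟨ R ⟩) → ν R + 1 ≤ ∣ R ∣
    rest-dense C-strict C′⊆C C⊈C′ disjoint = +-cancelˡ-≤ (∣ C′ ∣ + ν C′) _ _ (begin
      ∣ C′ ∣ + ν C′ + (ν R + 1)                ≡⟨ shuffle₁ (∣ C′ ∣) (ν C′) (ν R) ⟩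
      suc (∣ C′ ∣ + (ν C′ + ν R))              ≡⟨ cong (λ m → suc (∣ C′ ∣ + m)) (∣p∪q∣-disjoint A V⟨ R ⟩ disjoint) ⟨
      suc (∣ C′ ∣ + ∣ A ∪ V⟨ R ⟩ ∣)            ≤⟨ s≤s (+-monoʳ-≤ (∣ C′ ∣) (p⊆q⇒∣p∣≤∣q∣
                                                    (∪-lub (V⟨⟩-mono C′⊆C) (V⟨⟩-mono (p∖q⊆p C C′))))) ⟩
      suc (∣ C′ ∣ + ν C)                       ≤⟨ ≰⇒> (λ C≤C′ → C⊈C′ (C-strict C′ C′⊆C C≤C′)) ⟩
      ∣ C ∣ + ν C′                             ≡⟨ cong (_+ ν C′) (q⊆p⇒∣p∣≡∣q∣+∣p∖q∣ C C′ C′⊆C) ⟩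
      ∣ C′ ∣ + ∣ R ∣ + ν C′                    ≡⟨ shuffle₂ (∣ C′ ∣) (∣ R ∣) (ν C′) ⟩
      ∣ C′ ∣ + ν C′ + ∣ R ∣                    ∎)
      where
      open ≤-Reasoning
      shuffle₁ : ∀ a b c → a + b + (c + 1) ≡ suc (a + (b + c))
      shuffle₁ = solve-∀
      shuffle₂ : ∀ a b c → a + b + c ≡ a + c + b
      shuffle₂ = solve-∀

    find-ear : Strict C → C′ ⊆ C → ¬ C ⊆ C′ → EarInside
    find-ear C-strict C′⊆C C⊈C′
      with any? (λ e → (e ∈? R) ×-dec ((src e ∈? A) ⊎-dec (tgt e ∈? A)))
    ... | yes (e , e∈ , end) = start (attachment end)
      where
      attachment : src e ∈ A ⊎ tgt e ∈ A → ∃[ x ] ∃[ z ] (x ∈ A × Joins e x z)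
      attachment (inj₁ x∈) = _ , _ , x∈ , inj₁ (refl , refl)
      attachment (inj₂ x∈) = _ , _ , x∈ , inj₂ (refl , refl)
      start : ∃[ x ] ∃[ z ] (x ∈ A × Joins e x z) → EarInside
      -- The trivial trail at `x` already has one vertex, so `order` further steps exceed the
      -- available vertices.
      start (_ , _ , x∈A , joins) = grow (strict⇒¬leaf C-strict) order ε (All.[] ∷ [])
        (≤-reflexive (+-comm 1 order)) x∈A (λ { (here refl) _ → refl }) e∈ (λ ()) joins
    ... | no none =
      let B , B⊆R , circuit = dense⇒circuit⊆ R ≤-refl (rest-dense C-strict C′⊆C C⊈C′ (disjoint λ e∈ → e∈))
      in B , B⊆R , bicycle⇒attached (circuit⇒bicycle circuit) (disjoint B⊆R)
      where
      disjoint : ∀ {B} → B ⊆ R → Empty (A ∩ V⟨ B ⟩)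
      disjoint {B} B⊆R (v , v∈) with x∈p∩q⁻ A V⟨ B ⟩ v∈
      ... | v∈A , v∈B with ∈V⟨⟩⁻ {X = B} v∈B
      ...   | e , e∈ , inj₁ refl = none (e , B⊆R e∈ , inj₁ v∈A)
      ...   | e , e∈ , inj₂ refl = none (e , B⊆R e∈ , inj₂ v∈A)

  -- Ear decomposition and the inductive step

  LastEar : Subset size → Set
  LastEar C = ∃[ C′ ] ∃[ Y ] (Strict C′ × Empty (Y ∩ C′) × Attached V⟨ C′ ⟩ (G ⟨ Y ⟩) × C ≡ C′ ∪ Y)

  -- An ear inside `C` is added to `C′`. Either this gives `C` and the ear is the last one, or the
  -- union is again strict and the process continues from it; it is properly larger because an ear
  -- has an edge.
  last-ear : ∀ {C} → Strict C → ∀ C′ → Acc _⊃_ C′ → Strict C′ → C′ ⊆ C → ¬ C ⊆ C′ → LastEar C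
  last-ear {C} C-strict C′ (acc rec) C′-strict C′⊆C C⊈C′ =
    let Y , Y⊆R , attached = find-ear C C′ C-strict C′⊆C C⊈C′ in add Y Y⊆R attached
    where
    add : ∀ Y → Y ⊆ C ∖ C′ → Attached V⟨ C′ ⟩ (G ⟨ Y ⟩) → LastEar C
    add Y Y⊆R attached = continue (C ⊆? (C′ ∪ Y))
      where
      C′∪Y⊆C : C′ ∪ Y ⊆ C
      C′∪Y⊆C = ∪-lub C′⊆C (λ e∈ → p∖q⊆p C C′ (Y⊆R e∈))
      disjoint : Empty (Y ∩ C′)
      disjoint (e , e∈) = let e∈Y , e∈C′ = x∈p∩q⁻ Y C′ e∈ in proj₂ (x∈p∖q⁻ C C′ (Y⊆R e∈Y)) e∈C′
      ear : Ear V⟨ C′ ⟩ (G ⟨ Y ⟩)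
      ear = attached⇒ear attached
      C′⊂C′∪Y : C′ ⊂ C′ ∪ Y
      C′⊂C′∪Y = let e , e∈ = 0<∣p∣⇒Nonempty Y (≤-trans (s≤s z≤n) (≤-reflexive (sym (Ear.count ear)))) in
        p⊆p∪q Y , e , q⊆p∪q C′ Y e∈ , proj₂ (x∈p∖q⁻ C C′ (Y⊆R e∈))
      continue : Dec (C ⊆ C′ ∪ Y) → LastEar C
      continue (yes C⊆) = C′ , Y , C′-strict , disjoint , attached , ⊆-antisym C⊆ C′∪Y⊆C
      continue (no C⊈) = last-ear C-strict (C′ ∪ Y) (rec C′⊂C′∪Y)
        (AddEar.strict {P = G ⟨ Y ⟩} ear disjoint (V⟨⟩-∪ C′ Y) C′-strict) C′∪Y⊆C C⊈

  circuit⇒ear-decomposition : ∀ {k C} → 1 ≤ k → IsCircuit G (suc k) C →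
    ∃[ C′ ] Σ[ P ∈ Subgraph G ]
      (IsCircuit G k C′ × Empty (E P ∩ C′) × G ⟨ C ⟩ ≈ G ⟨ C′ ⟩ ∪ᴳ P × Attached V⟨ C′ ⟩ P)
  circuit⇒ear-decomposition {k} {C} 1≤k circuit@(((_ , e∈) , ∣C∣≡) , _) =
    decompose (last-ear (circuit⇒strict (s≤s z≤n) circuit) ⊥ (⊃-wellFounded ⊥)
      (λ _ _ _ e∈⊥ → ⊥-elim (∉⊥ e∈⊥)) ⊥⊆ (λ C⊆⊥ → ∉⊥ (C⊆⊥ e∈)))
    where
    open ≡-Reasoning
    shuffle : ∀ a b c → a + suc b + c ≡ suc a + (c + b)
    shuffle = solve-∀
    decompose : LastEar C → _
    decompose (C′ , Y , strict , disjoint , attached , refl) =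
      -- The last ear raises the defect by exactly one, so `C′` has defect `k`.
      C′ , G ⟨ Y ⟩ , strict⇒circuit 1≤k strict (+-cancelˡ-≡ (suc (ν C)) _ _ (begin
        suc (ν C) + ∣ C′ ∣           ≡⟨ cong suc (+-comm (ν C) _) ⟩
        suc (∣ C′ ∣ + ν C)           ≡⟨ AddEar.defect-suc {P = G ⟨ Y ⟩} (attached⇒ear attached) disjoint (V⟨⟩-∪ C′ Y) ⟨
        ∣ C ∣ + ν C′                 ≡⟨ cong (_+ ν C′) ∣C∣≡ ⟩
        ν C + suc k + ν C′           ≡⟨ shuffle (ν C) k (ν C′) ⟩
        suc (ν C) + (ν C′ + k)       ∎)) ,
      disjoint , (V⟨⟩-∪ C′ Y , refl) , attached

  circuit-add-ear : ∀ {k C C′ P} → 1 ≤ k → IsCircuit G k C′ → Empty (E P ∩ C′) →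
    G ⟨ C ⟩ ≈ G ⟨ C′ ⟩ ∪ᴳ P → Attached V⟨ C′ ⟩ P → IsCircuit G (suc k) C
  circuit-add-ear {k} {C} {C′} {P} 1≤k circuit@((_ , ∣C′∣≡) , _) disjoint (V≡ , refl) attached =
    strict⇒circuit (s≤s z≤n) (Added.strict (circuit⇒strict 1≤k circuit)) (+-cancelʳ-≡ (ν C′) _ _ (begin
      ∣ C ∣ + ν C′                 ≡⟨ Added.defect-suc ⟩
      suc (∣ C′ ∣ + ν C)           ≡⟨ cong (λ m → suc (m + ν C)) ∣C′∣≡ ⟩
      suc (ν C′ + k + ν C)         ≡⟨ shuffle (ν C′) k (ν C) ⟩
      ν C + suc k + ν C′           ∎))
    where
    module Added = AddEar {P = P} (attached⇒ear attached) disjoint V≡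
    open ≡-Reasoning
    shuffle : ∀ a b c → suc (a + b + c) ≡ c + suc b + a
    shuffle = solve-∀

open Graph
open Subgraph

mainTheorem9 : ∀ (G : Graph) (C : Subset (size G)) (k : ℕ) → 1 ≤ k →
    (k ≡ 1 → IsCircuit G 1 C ⇔ IsBicycle (G ⟨ C ⟩)) ×
    (2 ≤ k → IsCircuit G k C ⇔
    (Σ[ C′ ∈ Subset (size G) ] Σ[ P ∈ Subgraph G ]
    (IsCircuit G (k ∸ 1) C′ ×
    Empty (E P ∩ C′) ×
    G ⟨ C ⟩ ≈ G ⟨ C′ ⟩ ∪ᴳ P ×
    (IsPath P ⊎ IsCycle P ⊎ IsLollipop P ⊎ IsBicycle P) ×
    (∀ x → LollipopWithEnd P x → V (G ⟨ C′ ⟩) ∩ V P ≡ ⁅ x ⁆) ×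
    (∀ x y → PathWithEnds P x y → V (G ⟨ C′ ⟩) ∩ V P ≡ ⁅ x ⁆ ∪ ⁅ y ⁆) ×
    (IsCycle P → ∣ V (G ⟨ C′ ⟩) ∩ V P ∣ ≡ 1) ×
    (IsBicycle P → Empty (V (G ⟨ C′ ⟩) ∩ V P)))))
mainTheorem9 G C k _ =
  (λ _ → mk⇔ (EarDecomposition.circuit⇒bicycle G) (EarDecomposition.bicycle⇒circuit G)) ,
  -- Matching on the bound exposes `k` as a successor, so that `k ∸ 1` reduces.
  (λ { (s≤s 1≤k) → mk⇔ (EarDecomposition.circuit⇒ear-decomposition G 1≤k)
         (λ (C′ , P , circuit , disjoint , union , attached) →
           EarDecomposition.circuit-add-ear G 1≤k circuit disjoint union attached) })
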